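{- Let $r\geq 1$ and $K$ be integers. (i) If $K\geq r+1$, then for every real $u>0$, $$\sum_{\substack{k_0+k_1+\cdots+k_r=K\\ k_0,k_1,\dots,k_r\geq 1}}\ \sum_{n_1\geq\cdots\geq n_r\geq 1}\frac{1}{(n_1+u-1)^{k_0}(n_1+u)^{k_1}(n_2+u)^{k_2}\cdots(n_r+u)^{k_r}}=\frac{1}{u^{K-r}}.$$ (ii) For every integer $m\geq 2$, $$\sum_{\substack{k_1+\cdots+k_r=K\\ k_1\geq 2,\ k_2,\dots,k_r\geq 1}}(k_1-1)\sum_{n_1\geq n_2\geq\cdots\geq n_r\geq m}\frac{1}{n_1^{k_1}n_2^{k_2}\cdots n_r^{k_r}}<\frac{1}{(m-1)^{K-r}}.$$
   Context: All summation indices $k_i$ and $n_i$ are integers; the outer sums are finite sums over tuples of positive integers with the indicated constraints (an empty sum is $0$). -}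

module Defs where

open import Data.Nat.Base as ℕ using (ℕ; zero; suc; z≤n)
import Data.Nat.Properties as ℕ
open import Data.Integer.Base as ℤ using (ℤ; +_; -[1+_])
import Data.Integer.Properties as ℤ
open import Data.Rational.Base as ℚ using (ℚ; 0ℚ; 1ℚ; ½)
import Data.Rational.Properties as ℚ
open import Data.Rational.Solver using (module +-*-Solver)
import Data.Rational.Unnormalised.Base as ℚᵘ
import Data.Rational.Unnormalised.Properties as ℚᵘ
open import Data.List.Base as List using (List; []; _∷_; concatMap; upTo; filter)
open import Data.Vec.Base as Vec using (Vec; []; _∷_; head; zipWith)
open import Data.Product.Base using (∃; _×_; _,_; proj₁; proj₂)
open import Data.Sum.Base using (inj₁; inj₂)
open import Relation.Binary.PropositionalEquality.Core
  using (_≡_; refl; sym; trans; cong; cong₂; subst)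

open +-*-Solver using (solve; con; _:+_; _:*_; _:-_; :-_; _:=_)

ring₁ : ∀ p q → ℚ.- (p ℚ.- q) ≡ q ℚ.- p
ring₁ = solve 2 (λ p q → :- (p :- q) := q :- p) refl

ring₂ : ∀ p q → q ℚ.+ (p ℚ.- q) ≡ p
ring₂ = solve 2 (λ p q → q :+ (p :- q) := p) refl

ring₃ : ∀ a b → (a ℚ.+ b) ℚ.- a ≡ b
ring₃ = solve 2 (λ a b → (a :+ b) :- a := b) refl

ring₄ : ∀ a b c d → (a ℚ.- c) ℚ.+ (b ℚ.- d) ≡ (a ℚ.+ b) ℚ.- (c ℚ.+ d)
ring₄ = solve 4 (λ a b c d → (a :- c) :+ (b :- d) := (a :+ b) :- (c :+ d)) refl

ring₅ : ∀ a b → ℚ.- (a ℚ.- b) ≡ (ℚ.- a) ℚ.- (ℚ.- b)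
ring₅ = solve 2 (λ a b → :- (a :- b) := (:- a) :- (:- b)) refl

ring₆ : ∀ a b c d → a ℚ.* (b ℚ.- d) ℚ.+ d ℚ.* (a ℚ.- c) ≡ a ℚ.* b ℚ.- c ℚ.* d
ring₆ = solve 4 (λ a b c d → a :* (b :- d) :+ d :* (a :- c) := a :* b :- c :* d) refl

ring₇ : ∀ a b e v → a ℚ.* (e ℚ.* v) ℚ.+ b ℚ.* (e ℚ.* v) ≡ e ℚ.* ((a ℚ.+ b) ℚ.* v)
ring₇ = solve 4 (λ a b e v → a :* (e :* v) :+ b :* (e :* v) := e :* ((a :+ b) :* v)) refl

ring₈ : ∀ a b v u → (b ℚ.* u) ℚ.* v ℚ.- (a ℚ.* v) ℚ.* u ≡ (b ℚ.- a) ℚ.* (v ℚ.* u)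
ring₈ = solve 4 (λ a b v u → (b :* u) :* v :- (a :* v) :* u := (b :- a) :* (v :* u)) refl

ring₉ : ∀ e d v → (e ℚ.* (d ℚ.* d)) ℚ.* (v ℚ.* v) ≡ e ℚ.* ((d ℚ.* v) ℚ.* (d ℚ.* v))
ring₉ = solve 3 (λ e d v → (e :* (d :* d)) :* (v :* v) := e :* ((d :* v) :* (d :* v))) refl

ring₁₀ : ∀ v → (1ℚ ℚ.+ v) ℚ.- 1ℚ ≡ v
ring₁₀ = solve 1 (λ v → (con 1ℚ :+ v) :- con 1ℚ := v) refl

0<½ε : ∀ {ε} → 0ℚ ℚ.< ε → 0ℚ ℚ.< ½ ℚ.* ε
0<½ε {ε} 0<ε = subst (ℚ._< ½ ℚ.* ε) (ℚ.*-zeroʳ ½) (ℚ.*-monoʳ-<-pos ½ 0<ε)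

½ε+½ε : ∀ ε → ½ ℚ.* ε ℚ.+ ½ ℚ.* ε ≡ ε
½ε+½ε ε = trans (sym (ℚ.*-distribʳ-+ ε ½ ½)) (ℚ.*-identityˡ ε)

0<* : ∀ p q → 0ℚ ℚ.< p → 0ℚ ℚ.< q → 0ℚ ℚ.< p ℚ.* q
0<* p q 0<p 0<q = ℚ.positive⁻¹ (p ℚ.* q)
  {{ℚ.pos*pos⇒pos p {{ℚ.positive 0<p}} q {{ℚ.positive 0<q}}}}

*-mono-≤ : ∀ p q r s → 0ℚ ℚ.≤ r → 0ℚ ℚ.≤ q →
           p ℚ.≤ q → r ℚ.≤ s → p ℚ.* r ℚ.≤ q ℚ.* s
*-mono-≤ p q r s 0≤r 0≤q p≤q r≤s = ℚ.≤-trans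
  (ℚ.*-monoʳ-≤-nonNeg r {{ℚ.nonNegative 0≤r}} p≤q)
  (ℚ.*-monoˡ-≤-nonNeg q {{ℚ.nonNegative 0≤q}} r≤s)

p≤∣p∣ : ∀ p → p ℚ.≤ ℚ.∣ p ∣
p≤∣p∣ p with ℚ.≤-total 0ℚ p
... | inj₁ 0≤p = ℚ.≤-reflexive (sym (ℚ.0≤p⇒∣p∣≡p 0≤p))
... | inj₂ p≤0 = ℚ.≤-trans p≤0 (ℚ.0≤∣p∣ p)

∣p∣≤ : ∀ {p c} → p ℚ.≤ c → ℚ.- p ℚ.≤ c → ℚ.∣ p ∣ ℚ.≤ c
∣p∣≤ {p} {c} p≤c -p≤c with ℚ.∣p∣≡p∨∣p∣≡-p p
... | inj₁ eq = subst (ℚ._≤ c) (sym eq) p≤c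
... | inj₂ eq = subst (ℚ._≤ c) (sym eq) -p≤c

∣p-q∣≡∣q-p∣ : ∀ p q → ℚ.∣ p ℚ.- q ∣ ≡ ℚ.∣ q ℚ.- p ∣
∣p-q∣≡∣q-p∣ p q = trans (sym (ℚ.∣-p∣≡∣p∣ (p ℚ.- q))) (cong ℚ.∣_∣
  (ring₁ p q))

∣p∣≤∣q∣+∣p-q∣ : ∀ p q → ℚ.∣ p ∣ ℚ.≤ ℚ.∣ q ∣ ℚ.+ ℚ.∣ p ℚ.- q ∣
∣p∣≤∣q∣+∣p-q∣ p q = subst (λ t → ℚ.∣ t ∣ ℚ.≤ ℚ.∣ q ∣ ℚ.+ ℚ.∣ p ℚ.- q ∣)
  (ring₂ p q)
  (ℚ.∣p+q∣≤∣p∣+∣q∣ q (p ℚ.- q))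

∣p∣-∣q∣≤∣p-q∣ : ∀ p q → ℚ.∣ p ∣ ℚ.- ℚ.∣ q ∣ ℚ.≤ ℚ.∣ p ℚ.- q ∣
∣p∣-∣q∣≤∣p-q∣ p q = subst (ℚ.∣ p ∣ ℚ.- ℚ.∣ q ∣ ℚ.≤_)
  (ring₃ ℚ.∣ q ∣ ℚ.∣ p ℚ.- q ∣)
  (ℚ.+-monoˡ-≤ (ℚ.- ℚ.∣ q ∣) (∣p∣≤∣q∣+∣p-q∣ p q))

∣∣p∣-∣q∣∣≤∣p-q∣ : ∀ p q → ℚ.∣ ℚ.∣ p ∣ ℚ.- ℚ.∣ q ∣ ∣ ℚ.≤ ℚ.∣ p ℚ.- q ∣
∣∣p∣-∣q∣∣≤∣p-q∣ p q = ∣p∣≤ (∣p∣-∣q∣≤∣p-q∣ p q)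
  (subst (ℚ._≤ ℚ.∣ p ℚ.- q ∣)
    (sym (ring₁ ℚ.∣ p ∣ ℚ.∣ q ∣))
    (subst (ℚ.∣ q ∣ ℚ.- ℚ.∣ p ∣ ℚ.≤_) (∣p-q∣≡∣q-p∣ q p)
      (∣p∣-∣q∣≤∣p-q∣ q p)))

∣δ⊔p-δ⊔q∣≤∣p-q∣ : ∀ δ p q → ℚ.∣ (δ ℚ.⊔ p) ℚ.- (δ ℚ.⊔ q) ∣ ℚ.≤ ℚ.∣ p ℚ.- q ∣
∣δ⊔p-δ⊔q∣≤∣p-q∣ δ p q = ∣p∣≤ (half p q)
  (subst (ℚ._≤ ℚ.∣ p ℚ.- q ∣)
    (sym (ring₁ (δ ℚ.⊔ p) (δ ℚ.⊔ q)))
    (subst ((δ ℚ.⊔ q) ℚ.- (δ ℚ.⊔ p) ℚ.≤_) (∣p-q∣≡∣q-p∣ q p) (half q p)))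
  where
  half : ∀ p q → (δ ℚ.⊔ p) ℚ.- (δ ℚ.⊔ q) ℚ.≤ ℚ.∣ p ℚ.- q ∣
  half p q with ℚ.≤-total δ p
  ... | inj₁ δ≤p = subst (λ t → t ℚ.- (δ ℚ.⊔ q) ℚ.≤ ℚ.∣ p ℚ.- q ∣)
    (sym (ℚ.p≤q⇒p⊔q≡q δ≤p))
    (ℚ.≤-trans (ℚ.+-monoʳ-≤ p (ℚ.neg-antimono-≤ (ℚ.p≤q⊔p δ q))) (p≤∣p∣ (p ℚ.- q)))
  ... | inj₂ p≤δ = subst (λ t → t ℚ.- (δ ℚ.⊔ q) ℚ.≤ ℚ.∣ p ℚ.- q ∣)
    (sym (ℚ.p≥q⇒p⊔q≡p p≤δ))
    (ℚ.≤-trans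
      (subst (δ ℚ.- (δ ℚ.⊔ q) ℚ.≤_) (ℚ.+-inverseʳ δ)
        (ℚ.+-monoʳ-≤ δ (ℚ.neg-antimono-≤ (ℚ.p≤p⊔q δ q))))
      (ℚ.0≤∣p∣ (p ℚ.- q)))

∣ab-cd∣≤ : ∀ a b c d B C η → 0ℚ ℚ.≤ B → 0ℚ ℚ.≤ C →
  ℚ.∣ a ∣ ℚ.≤ B → ℚ.∣ d ∣ ℚ.≤ C → ℚ.∣ a ℚ.- c ∣ ℚ.≤ η → ℚ.∣ b ℚ.- d ∣ ℚ.≤ η →
  ℚ.∣ a ℚ.* b ℚ.- c ℚ.* d ∣ ℚ.≤ B ℚ.* η ℚ.+ C ℚ.* η
∣ab-cd∣≤ a b c d B C η 0≤B 0≤C ∣a∣≤B ∣d∣≤C ∣a-c∣≤η ∣b-d∣≤η =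
  subst (λ t → ℚ.∣ t ∣ ℚ.≤ B ℚ.* η ℚ.+ C ℚ.* η) (ring₆ a b c d)
    (ℚ.≤-trans (ℚ.∣p+q∣≤∣p∣+∣q∣ (a ℚ.* (b ℚ.- d)) (d ℚ.* (a ℚ.- c)))
      (ℚ.+-mono-≤ (bound a (b ℚ.- d) B 0≤B ∣a∣≤B ∣b-d∣≤η)
                  (bound d (a ℚ.- c) C 0≤C ∣d∣≤C ∣a-c∣≤η)))
  where
  bound : ∀ p q D → 0ℚ ℚ.≤ D → ℚ.∣ p ∣ ℚ.≤ D → ℚ.∣ q ∣ ℚ.≤ η →
          ℚ.∣ p ℚ.* q ∣ ℚ.≤ D ℚ.* η
  bound p q D 0≤D ∣p∣≤D ∣q∣≤η =
    subst (ℚ._≤ D ℚ.* η) (sym (ℚ.∣p*q∣≡∣p∣*∣q∣ p q))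
      (*-mono-≤ ℚ.∣ p ∣ D ℚ.∣ q ∣ η (ℚ.0≤∣p∣ q) 0≤D ∣p∣≤D ∣q∣≤η)

0<1/ : ∀ p .{{_ : ℚ.NonZero p}} → 0ℚ ℚ.< p → 0ℚ ℚ.< ℚ.1/ p
0<1/ p 0<p = ℚ.positive⁻¹ _ {{ℚ.1/pos⇒pos p {{ℚ.positive 0<p}}}}

1/-antimono : ∀ p q .{{_ : ℚ.NonZero p}} .{{_ : ℚ.NonZero q}} →
              0ℚ ℚ.< p → p ℚ.≤ q → ℚ.1/ q ℚ.≤ ℚ.1/ p
1/-antimono p q 0<p p≤q =
  ℚ.*-cancelʳ-≤-pos p {{ℚ.positive 0<p}}
    (subst (ℚ.1/ q ℚ.* p ℚ.≤_) (trans (ℚ.*-inverseˡ q) (sym (ℚ.*-inverseˡ p)))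
      (ℚ.*-monoˡ-≤-nonNeg (ℚ.1/ q)
        {{ℚ.nonNegative (ℚ.<⇒≤ (0<1/ q (ℚ.<-≤-trans 0<p p≤q)))}} p≤q))

share : ∀ B C ε → 0ℚ ℚ.< B → 0ℚ ℚ.< C → 0ℚ ℚ.< ε →
        ∃ λ η → 0ℚ ℚ.< η × B ℚ.* η ℚ.+ C ℚ.* η ≡ ε
share B C ε 0<B 0<C 0<ε = split (B ℚ.+ C) refl (ℚ.+-mono-< 0<B 0<C)
  where
  split : ∀ D → B ℚ.+ C ≡ D → 0ℚ ℚ.< D → ∃ λ η → 0ℚ ℚ.< η × B ℚ.* η ℚ.+ C ℚ.* η ≡ ε
  split D B+C≡D 0<D = ε ℚ.* ℚ.1/ D , 0<* ε (ℚ.1/ D) 0<ε (0<1/ D 0<D) ,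
    trans (ring₇ B C ε (ℚ.1/ D))
      (trans (cong (λ t → ε ℚ.* (t ℚ.* ℚ.1/ D)) B+C≡D)
        (trans (cong (ε ℚ.*_) (ℚ.*-inverseʳ D)) (ℚ.*-identityʳ ε)))
    where
    instance
      D≢0 : ℚ.NonZero D
      D≢0 = ℚ.>-nonZero 0<D

∣1/p-1/q∣≤ : ∀ p q δ ε .{{_ : ℚ.NonZero p}} .{{_ : ℚ.NonZero q}} →
  0ℚ ℚ.< δ → 0ℚ ℚ.< ε → δ ℚ.≤ p → δ ℚ.≤ q →
  ℚ.∣ q ℚ.- p ∣ ℚ.≤ ε ℚ.* (δ ℚ.* δ) → ℚ.∣ ℚ.1/ p ℚ.- ℚ.1/ q ∣ ℚ.≤ ε
∣1/p-1/q∣≤ p q δ ε 0<δ 0<ε δ≤p δ≤q h =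
  subst (ℚ._≤ ε) (sym ∣difference∣)
    (subst (ℚ.∣ q ℚ.- p ∣ ℚ.* (u ℚ.* v) ℚ.≤_) cancel
      (*-mono-≤ ℚ.∣ q ℚ.- p ∣ (ε ℚ.* (δ ℚ.* δ)) (u ℚ.* v) (w ℚ.* w)
        0≤uv (ℚ.<⇒≤ (0<* ε (δ ℚ.* δ) 0<ε (0<* δ δ 0<δ 0<δ))) h
        (*-mono-≤ u w v w (ℚ.<⇒≤ 0<v) (ℚ.<⇒≤ (0<1/ δ 0<δ))
          (1/-antimono δ p 0<δ δ≤p) (1/-antimono δ q 0<δ δ≤q))))
  where
  instance
    δ≢0 : ℚ.NonZero δ
    δ≢0 = ℚ.>-nonZero 0<δ
  u v w : ℚ
  u = ℚ.1/ p
  v = ℚ.1/ q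
  w = ℚ.1/ δ
  0<v : 0ℚ ℚ.< v
  0<v = 0<1/ q (ℚ.<-≤-trans 0<δ δ≤q)
  0≤uv : 0ℚ ℚ.≤ u ℚ.* v
  0≤uv = ℚ.<⇒≤ (0<* u v (0<1/ p (ℚ.<-≤-trans 0<δ δ≤p)) 0<v)
  difference : u ℚ.- v ≡ (q ℚ.- p) ℚ.* (u ℚ.* v)
  difference = trans
    (cong₂ ℚ._-_
      (trans (sym (ℚ.*-identityˡ u)) (cong (ℚ._* u) (sym (ℚ.*-inverseʳ q))))
      (trans (sym (ℚ.*-identityˡ v)) (cong (ℚ._* v) (sym (ℚ.*-inverseʳ p)))))
    (ring₈ p q u v)
  ∣difference∣ : ℚ.∣ u ℚ.- v ∣ ≡ ℚ.∣ q ℚ.- p ∣ ℚ.* (u ℚ.* v)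
  ∣difference∣ = trans (cong ℚ.∣_∣ difference)
    (trans (ℚ.∣p*q∣≡∣p∣*∣q∣ (q ℚ.- p) (u ℚ.* v))
      (cong (ℚ.∣ q ℚ.- p ∣ ℚ.*_) (ℚ.0≤p⇒∣p∣≡p 0≤uv)))
  cancel : (ε ℚ.* (δ ℚ.* δ)) ℚ.* (w ℚ.* w) ≡ ε
  cancel = trans (ring₉ ε δ w)
    (trans (cong (λ t → ε ℚ.* (t ℚ.* t)) (ℚ.*-inverseʳ δ)) (ℚ.*-identityʳ ε))

⊔-nonZero : ∀ {δ} → 0ℚ ℚ.< δ → ∀ p → ℚ.NonZero (δ ℚ.⊔ p)
⊔-nonZero {δ} 0<δ p = ℚ.>-nonZero (ℚ.<-≤-trans 0<δ (ℚ.p≤p⊔q δ p))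

1/⊔-lower : ∀ δ p B .{{_ : ℚ.NonZero (δ ℚ.⊔ p)}} → 0ℚ ℚ.< δ → 0ℚ ℚ.< B →
  ℚ.∣ p ∣ ℚ.≤ B → ∀ D → D ≡ δ ℚ.⊔ B → .{{_ : ℚ.NonZero D}} →
  0ℚ ℚ.+ ℚ.1/ D ℚ.≤ ℚ.1/ (δ ℚ.⊔ p)
1/⊔-lower δ p B 0<δ 0<B ∣p∣≤B D D≡δ⊔B =
  subst (ℚ._≤ ℚ.1/ (δ ℚ.⊔ p)) (sym (ℚ.+-identityˡ (ℚ.1/ D)))
    (1/-antimono (δ ℚ.⊔ p) D (ℚ.<-≤-trans 0<δ (ℚ.p≤p⊔q δ p))
      (subst (δ ℚ.⊔ p ℚ.≤_) (sym D≡δ⊔B)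
        (ℚ.⊔-monoʳ-≤ δ {B} {p} (ℚ.≤-trans (p≤∣p∣ p) ∣p∣≤B))))

Eventually : (ℕ → Set) → Set
Eventually P = ∃ λ N → ∀ n → N ℕ.≤ n → P n

record ℝ : Set where
  constructor mkℝ
  field
    seq    : ℕ → ℚ
    cauchy : ∀ ε → 0ℚ ℚ.< ε →
             ∃ λ N → ∀ i j → N ℕ.≤ i → N ℕ.≤ j → ℚ.∣ seq i ℚ.- seq j ∣ ℚ.≤ ε

open ℝ public

infix  4 _≈_ _<_
infixl 6 _+_ _-_
infixl 7 _*_ _*⁺_
infix  8 -_
infixr 8 _^⁺_ _^ᶻ_

_≈_ : ℝ → ℝ → Set
x ≈ y = ∀ ε → 0ℚ ℚ.< ε → Eventually λ n → ℚ.∣ seq x n ℚ.- seq y n ∣ ℚ.≤ ε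

_<_ : ℝ → ℝ → Set
x < y = ∃ λ δ → 0ℚ ℚ.< δ × Eventually λ n → seq x n ℚ.+ δ ℚ.≤ seq y n

fromℚ : ℚ → ℝ
fromℚ q = mkℝ (λ _ → q) λ ε 0<ε → 0 , λ _ _ _ _ →
  subst (ℚ._≤ ε) (sym (cong ℚ.∣_∣ (ℚ.+-inverseʳ q))) (ℚ.<⇒≤ 0<ε)

fromℕ : ℕ → ℝ
fromℕ n = fromℚ (+ n ℚ./ 1)

0ℝ 1ℝ : ℝ
0ℝ = fromℚ 0ℚ
1ℝ = fromℚ 1ℚ

_+_ : ℝ → ℝ → ℝ
x + y = mkℝ (λ n → seq x n ℚ.+ seq y n) λ ε 0<ε →
  let (M , hM) = cauchy x (½ ℚ.* ε) (0<½ε 0<ε)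
      (N , hN) = cauchy y (½ ℚ.* ε) (0<½ε 0<ε)
  in M ℕ.⊔ N , λ i j hi hj →
    subst (ℚ.∣ (seq x i ℚ.+ seq y i) ℚ.- (seq x j ℚ.+ seq y j) ∣ ℚ.≤_) (½ε+½ε ε)
      (subst (λ t → ℚ.∣ t ∣ ℚ.≤ ½ ℚ.* ε ℚ.+ ½ ℚ.* ε)
        (ring₄
          (seq x i) (seq y i) (seq x j) (seq y j))
        (ℚ.≤-trans (ℚ.∣p+q∣≤∣p∣+∣q∣ (seq x i ℚ.- seq x j) (seq y i ℚ.- seq y j))
          (ℚ.+-mono-≤ (hM i j (ℕ.m⊔n≤o⇒m≤o M N hi) (ℕ.m⊔n≤o⇒m≤o M N hj))
                      (hN i j (ℕ.m⊔n≤o⇒n≤o M N hi) (ℕ.m⊔n≤o⇒n≤o M N hj)))))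

-_ : ℝ → ℝ
- x = mkℝ (λ n → ℚ.- seq x n) λ ε 0<ε →
  let (N , hN) = cauchy x ε 0<ε
  in N , λ i j hi hj →
    subst (ℚ._≤ ε)
      (trans (sym (ℚ.∣-p∣≡∣p∣ (seq x i ℚ.- seq x j))) (cong ℚ.∣_∣
        (ring₅ (seq x i) (seq x j))))
      (hN i j hi hj)

_-_ : ℝ → ℝ → ℝ
x - y = x + - y

∣_∣ : ℝ → ℝ
∣ x ∣ = mkℝ (λ n → ℚ.∣ seq x n ∣) λ ε 0<ε →
  let (N , hN) = cauchy x ε 0<ε
  in N , λ i j hi hj →
    ℚ.≤-trans (∣∣p∣-∣q∣∣≤∣p-q∣ (seq x i) (seq x j)) (hN i j hi hj)

bounded : ∀ x → ∃ λ B → 0ℚ ℚ.< B × Eventually λ n → ℚ.∣ seq x n ∣ ℚ.≤ B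
bounded x with cauchy x 1ℚ (ℚ.positive⁻¹ 1ℚ)
... | N , hN = ℚ.∣ seq x N ∣ ℚ.+ 1ℚ
    , ℚ.+-mono-≤-< (ℚ.0≤∣p∣ (seq x N)) (ℚ.positive⁻¹ 1ℚ)
    , N , λ n N≤n → ℚ.≤-trans (∣p∣≤∣q∣+∣p-q∣ (seq x n) (seq x N))
        (ℚ.+-monoʳ-≤ ℚ.∣ seq x N ∣ (hN n N N≤n ℕ.≤-refl))

_*_ : ℝ → ℝ → ℝ
x * y = mkℝ (λ n → seq x n ℚ.* seq y n) *-cauchy
  where
  *-cauchy : ∀ ε → 0ℚ ℚ.< ε → ∃ λ N → ∀ i j → N ℕ.≤ i → N ℕ.≤ j →
    ℚ.∣ seq x i ℚ.* seq y i ℚ.- seq x j ℚ.* seq y j ∣ ℚ.≤ ε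
  *-cauchy ε 0<ε =
    let (B , 0<B , Nx , hB) = bounded x
        (C , 0<C , Ny , hC) = bounded y
        (η , 0<η , total)   = share B C ε 0<B 0<C 0<ε
        (Mx , hx)           = cauchy x η 0<η
        (My , hy)           = cauchy y η 0<η
        N₁ = Nx ℕ.⊔ Ny
        N₂ = Mx ℕ.⊔ My
    in N₁ ℕ.⊔ N₂ , λ i j hi hj →
      let hi₁ = ℕ.m⊔n≤o⇒m≤o N₁ N₂ hi
          hj₁ = ℕ.m⊔n≤o⇒m≤o N₁ N₂ hj
          hi₂ = ℕ.m⊔n≤o⇒n≤o N₁ N₂ hi
          hj₂ = ℕ.m⊔n≤o⇒n≤o N₁ N₂ hj
      in subst (ℚ.∣ seq x i ℚ.* seq y i ℚ.- seq x j ℚ.* seq y j ∣ ℚ.≤_) total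
          (∣ab-cd∣≤ (seq x i) (seq y i) (seq x j) (seq y j) B C η
            (ℚ.<⇒≤ 0<B) (ℚ.<⇒≤ 0<C)
            (hB i (ℕ.m⊔n≤o⇒m≤o Nx Ny hi₁)) (hC j (ℕ.m⊔n≤o⇒n≤o Nx Ny hj₁))
            (hx i j (ℕ.m⊔n≤o⇒m≤o Mx My hi₂) (ℕ.m⊔n≤o⇒m≤o Mx My hj₂))
            (hy i j (ℕ.m⊔n≤o⇒n≤o Mx My hi₂) (ℕ.m⊔n≤o⇒n≤o Mx My hj₂)))

ℝ⁺ : Set
ℝ⁺ = ∃ λ x → 0ℝ < x

⟦_⟧ : ℝ⁺ → ℝ
⟦_⟧ = proj₁

-- If δ witnesses 0 < x, then δ ≤ xₙ for all large n, so δ ⊔ xₙ is eventually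
-- xₙ; the maximum only keeps the finitely many other entries invertible.
recip : ∀ x → 0ℝ < x → ℝ
recip x (δ , 0<δ , _) = mkℝ (λ n → ℚ.1/ (δ ℚ.⊔ seq x n)) recip-cauchy
  where
  instance
    δ⊔x≢0 : ∀ {n} → ℚ.NonZero (δ ℚ.⊔ seq x n)
    δ⊔x≢0 {n} = ⊔-nonZero 0<δ (seq x n)
  recip-cauchy : ∀ ε → 0ℚ ℚ.< ε → ∃ λ N → ∀ i j → N ℕ.≤ i → N ℕ.≤ j →
    ℚ.∣ ℚ.1/ (δ ℚ.⊔ seq x i) ℚ.- ℚ.1/ (δ ℚ.⊔ seq x j) ∣ ℚ.≤ ε
  recip-cauchy ε 0<ε =
    let (N , hN) = cauchy x (ε ℚ.* (δ ℚ.* δ)) (0<* ε (δ ℚ.* δ) 0<ε (0<* δ δ 0<δ 0<δ))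
    in N , λ i j hi hj →
      ∣1/p-1/q∣≤ (δ ℚ.⊔ seq x i) (δ ℚ.⊔ seq x j) δ ε 0<δ 0<ε
        (ℚ.p≤p⊔q δ (seq x i)) (ℚ.p≤p⊔q δ (seq x j))
        (ℚ.≤-trans (∣δ⊔p-δ⊔q∣≤∣p-q∣ δ (seq x j) (seq x i)) (hN j i hj hi))

recip-positive : ∀ x 0<x → 0ℝ < recip x 0<x
recip-positive x (δ , 0<δ , _) =
  let (B , 0<B , N , hB) = bounded x
      D   = δ ℚ.⊔ B
      0<D = ℚ.<-≤-trans 0<δ (ℚ.p≤p⊔q δ B)
  in (ℚ.1/ D) {{⊔-nonZero 0<δ B}} , 0<1/ D {{⊔-nonZero 0<δ B}} 0<D , N , λ n N≤n →
    1/⊔-lower δ (seq x n) B {{⊔-nonZero 0<δ (seq x n)}} 0<δ 0<B (hB n N≤n)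
      D refl {{⊔-nonZero 0<δ B}}

1/⁺_ : ℝ⁺ → ℝ⁺
1/⁺ (x , 0<x) = recip x 0<x , recip-positive x 0<x

1⁺ : ℝ⁺
1⁺ = 1ℝ , 1ℚ , ℚ.positive⁻¹ 1ℚ , 0 , λ _ _ → ℚ.≤-refl

_*⁺_ : ℝ⁺ → ℝ⁺ → ℝ⁺
(x , δ , 0<δ , M , hM) *⁺ (y , η , 0<η , N , hN) =
  x * y , δ ℚ.* η , 0<* δ η 0<δ 0<η , M ℕ.⊔ N , λ n hn →
    let δ≤x = subst (ℚ._≤ seq x n) (ℚ.+-identityˡ δ) (hM n (ℕ.m⊔n≤o⇒m≤o M N hn))
        η≤y = subst (ℚ._≤ seq y n) (ℚ.+-identityˡ η) (hN n (ℕ.m⊔n≤o⇒n≤o M N hn))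
    in subst (ℚ._≤ seq x n ℚ.* seq y n) (sym (ℚ.+-identityˡ (δ ℚ.* η)))
        (*-mono-≤ δ (seq x n) η (seq y n) (ℚ.<⇒≤ 0<η) (ℚ.≤-trans (ℚ.<⇒≤ 0<δ) δ≤x) δ≤x η≤y)

_^⁺_ : ℝ⁺ → ℕ → ℝ⁺
x ^⁺ zero  = 1⁺
x ^⁺ suc n = x *⁺ x ^⁺ n

_^ᶻ_ : ℝ⁺ → ℤ → ℝ⁺
x ^ᶻ (+ n)    = x ^⁺ n
x ^ᶻ -[1+ n ] = 1/⁺ (x ^⁺ suc n)

∏⁺ : ∀ {r} → Vec ℝ⁺ r → ℝ⁺
∏⁺ = Vec.foldr′ _*⁺_ 1⁺

fromℕ-mono-≤ : ∀ {a b} → a ℕ.≤ b → + a ℚ./ 1 ℚ.≤ + b ℚ./ 1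
fromℕ-mono-≤ {a} {b} a≤b = ℚ.toℚᵘ-cancel-≤
  (ℚᵘ.≤-respˡ-≃ (ℚᵘ.≃-sym (ℚ.toℚᵘ-fromℚᵘ (ℚᵘ.mkℚᵘ (+ a) 0)))
    (ℚᵘ.≤-respʳ-≃ (ℚᵘ.≃-sym (ℚ.toℚᵘ-fromℚᵘ (ℚᵘ.mkℚᵘ (+ b) 0)))
      (ℚᵘ.*≤* (ℤ.*-monoʳ-≤-nonNeg (+ 1) (ℤ.+≤+ a≤b)))))

nat⁺ : ∀ n → 1 ℕ.≤ n → ℝ⁺
nat⁺ n 1≤n = fromℕ n , 1ℚ , ℚ.positive⁻¹ 1ℚ , 0 , λ _ _ → fromℕ-mono-≤ 1≤n

pred⁺ : ∀ m → 2 ℕ.≤ m → ℝ⁺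
pred⁺ m 2≤m = fromℕ m - 1ℝ , 1ℚ , ℚ.positive⁻¹ 1ℚ , 0 , λ _ _ →
  ℚ.+-monoˡ-≤ (ℚ.- 1ℚ) (fromℕ-mono-≤ 2≤m)

shift⁺ : ℝ⁺ → ℕ → ℝ⁺
shift⁺ (u , δ , 0<δ , N , h) n = fromℕ n + u , δ , 0<δ , N , λ i N≤i →
  ℚ.≤-trans (h i N≤i) (subst (ℚ._≤ + n ℚ./ 1 ℚ.+ seq u i) (ℚ.+-identityˡ (seq u i))
    (ℚ.+-monoˡ-≤ (seq u i) (fromℕ-mono-≤ {0} {n} z≤n)))

shift-1⁺ : ℝ⁺ → ∀ n → 1 ℕ.≤ n → ℝ⁺
shift-1⁺ (u , δ , 0<δ , N , h) n 1≤n = fromℕ n + u - 1ℝ , δ , 0<δ , N , λ i N≤i →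
  ℚ.≤-trans (h i N≤i)
    (subst (ℚ._≤ + n ℚ./ 1 ℚ.+ seq u i ℚ.- 1ℚ)
      (ring₁₀ (seq u i))
      (ℚ.+-monoˡ-≤ (ℚ.- 1ℚ) (ℚ.+-monoˡ-≤ (seq u i) (fromℕ-mono-≤ {1} {n} 1≤n))))

-- All (k₁ , … , kᵣ) with every kᵢ ≥ 1 and k₁ + ⋯ + kᵣ = K; the first entry
-- suc i is at most K, so the subtraction does not truncate.
compositionsℕ : ∀ r → ℕ → List (Vec ℕ r)
compositionsℕ zero    zero    = [] ∷ []
compositionsℕ zero    (suc _) = []
compositionsℕ (suc r) K       =
  concatMap (λ i → List.map (suc i ∷_) (compositionsℕ r (K ℕ.∸ suc i))) (upTo K)

compositions : ∀ r → ℤ → List (Vec ℕ r)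
compositions r (+ K)    = compositionsℕ r K
compositions r -[1+ _ ] = []

compositions-k₁≥2 : ∀ r → ℤ → List (Vec ℕ (suc r))
compositions-k₁≥2 r K = filter (λ k → 2 ℕ.≤? head k) (compositions (suc r) K)

ℕ≥ : ℕ → Set
ℕ≥ m = ∃ λ n → m ℕ.≤ n

-- m , m+1 , … , N  (empty when N < m)
range : ∀ m → ℕ → List (ℕ≥ m)
range m N = List.map (λ i → m ℕ.+ i , ℕ.m≤m+n m i) (upTo (suc N ℕ.∸ m))

-- All (n₁ , … , nᵣ) with N ≥ n₁ ≥ ⋯ ≥ nᵣ ≥ m.
chains : ∀ r m → ℕ → List (Vec (ℕ≥ m) r)
chains zero    m N = [] ∷ []
chains (suc r) m N =
  concatMap (λ n → List.map (n ∷_) (chains r m (proj₁ n))) (range m N)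

∑ : {A : Set} → List A → (A → ℝ) → ℝ
∑ xs f = List.foldr (λ x s → f x + s) 0ℝ xs

infix 4 _⟶_

_⟶_ : (ℕ → ℝ) → ℝ → Set
s ⟶ L = ∀ ε → 0ℝ < ε → Eventually λ N → ∣ s N - L ∣ < ε

-- S is the sum of the multiple series  Σ_{n₁ ≥ ⋯ ≥ nᵣ ≥ m} f (n₁ , … , nᵣ),
-- as the limit over N of the finite sums with n₁ ≤ N.
HasSum : ∀ r m → (Vec (ℕ≥ m) r → ℝ) → ℝ → Set
HasSum r m f S = (λ N → ∑ (chains r m N) f) ⟶ S

-- 1 / ((n₁+u-1)^k₀ (n₁+u)^k₁ ⋯ (nᵣ+u)^kᵣ)
term₁ : ∀ {r} → ℝ⁺ → Vec ℕ (suc (suc r)) → Vec (ℕ≥ 1) (suc r) → ℝ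
term₁ u (k₀ ∷ ks) ns@((n₁ , 1≤n₁) ∷ _) =
  ⟦ 1/⁺ (shift-1⁺ u n₁ 1≤n₁ ^⁺ k₀
         *⁺ ∏⁺ (zipWith (λ (n , _) k → shift⁺ u n ^⁺ k) ns ks)) ⟧

-- 1 / (n₁^k₁ ⋯ nᵣ^kᵣ)
term₂ : ∀ {r m} → 1 ℕ.≤ m → Vec ℕ r → Vec (ℕ≥ m) r → ℝ
term₂ 1≤m ks ns =
  ⟦ 1/⁺ ∏⁺ (zipWith (λ (n , m≤n) k → nat⁺ n (ℕ.≤-trans 1≤m m≤n) ^⁺ k) ns ks) ⟧

{-# OPTIONS --safe #-}

-- Put xₙ = 1/(n+u), so that xₙ₋₁xₙ = xₙ₋₁ - xₙ. Summing the left-hand side of (i) over k₀ and k₁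
-- turns each summand into a difference in n₁, and the sum over n₁ ≥ n₂ collapses to the same
-- expression with r and K both lowered by one; after r steps only x₀^(K-r) remains. Cutting the
-- sum off at n₁ ≤ N leaves error terms dominated, uniformly in u, by multiples of
-- (1/N) Σ_{N ≥ n₂ ≥ ⋯} 1/(n₂ ⋯), which tend to 0 by Cesàro's theorem. All summands being
-- nonnegative, each single series inherits a modulus of convergence from the total. The identities
-- are rational and hold exactly at every late index of the Cauchy sequence of u. For (ii), take
-- u = m - 1 and shift the nᵢ: replacing x(n₁ - 1) by the smaller x(n₁) merges k₀ and k₁ into one
-- exponent k₁ with multiplicity k₁ - 1, and the summand n₁ = ⋯ = nᵣ = m already makes this strict.
module Submission where

open import Data.Nat.Base as ℕ using (ℕ; zero; suc; z≤n; s≤s)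
import Data.Nat.Properties as ℕ
open import Data.Nat.Properties using (≤-trans; n≤1+n)
open import Data.Integer.Base as ℤ using (ℤ; +_; -[1+_])
import Data.Integer.Properties as ℤ
open import Data.Rational.Base as ℚ using (ℚ; 0ℚ; 1ℚ; ½)
import Data.Rational.Properties as ℚ
open import Data.Rational.Solver using (module +-*-Solver)
import Data.Rational.Unnormalised.Base as ℚᵘ
import Data.Rational.Unnormalised.Properties as ℚᵘ
open import Data.List.Base as List using (List; []; _∷_; _++_; concatMap; upTo; filter)
import Data.List.Properties as List
open import Data.List.Membership.Propositional using (_∈_; find)
open import Data.List.Membership.Propositional.Properties using (∈-concatMap⁻; ∈-map⁻; ∈-filter⁻)
import Data.List.Membership.DecPropositional as DecMembership
open import Data.List.Relation.Unary.Any using (here; there)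
open import Data.Vec.Base as Vec using (Vec; []; _∷_; head; tail; zipWith)
import Data.Vec.Properties as Vec
open import Data.Product.Base using (∃; _×_; _,_; proj₁; proj₂)
open import Data.Sum.Base using (inj₁; inj₂; [_,_]′)
open import Function.Base using (_∘_)
open import Relation.Nullary using (¬_; Dec; yes; no; contradiction)
open import Relation.Unary using (Decidable)
open import Relation.Binary.Definitions using (DecidableEquality)
open import Relation.Binary.PropositionalEquality
open import Algebra.Definitions.RawSemiring ℚ.+-*-rawSemiring using (_^_)
open import Defs
open +-*-Solver using (solve; con; _:+_; _:*_; _:-_; _:=_)

-- Order and arithmetic of the rationals

+-nonneg : ∀ {p q} → 0ℚ ℚ.≤ p → 0ℚ ℚ.≤ q → 0ℚ ℚ.≤ p ℚ.+ q
+-nonneg 0≤p 0≤q = ℚ.+-mono-≤ 0≤p 0≤q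

*-nonneg : ∀ {p q} → 0ℚ ℚ.≤ p → 0ℚ ℚ.≤ q → 0ℚ ℚ.≤ p ℚ.* q
*-nonneg {p} {q} 0≤p 0≤q = *-mono-≤ 0ℚ p 0ℚ q ℚ.≤-refl 0≤p 0≤p 0≤q

p≤p+q : ∀ p {q} → 0ℚ ℚ.≤ q → p ℚ.≤ p ℚ.+ q
p≤p+q p {q} 0≤q = subst (ℚ._≤ p ℚ.+ q) (ℚ.+-identityʳ p) (ℚ.+-monoʳ-≤ p 0≤q)

p≤q⇒0≤q-p : ∀ {p q} → p ℚ.≤ q → 0ℚ ℚ.≤ q ℚ.- p
p≤q⇒0≤q-p {p} {q} p≤q = subst (ℚ._≤ q ℚ.- p) (ℚ.+-inverseʳ p) (ℚ.+-monoˡ-≤ (ℚ.- p) p≤q)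

p≤q+r⇒p-q≤r : ∀ {p q r} → p ℚ.≤ q ℚ.+ r → p ℚ.- q ℚ.≤ r
p≤q+r⇒p-q≤r {p} {q} {r} h = subst (p ℚ.- q ℚ.≤_) (ring₃ q r) (ℚ.+-monoˡ-≤ (ℚ.- q) h)

0≤q-p⇒p≤q : ∀ {p q} → 0ℚ ℚ.≤ q ℚ.- p → p ℚ.≤ q
0≤q-p⇒p≤q {p} {q} h = subst (p ℚ.≤_) (ring₂ q p) (p≤p+q p h)

ι : ℕ → ℚ
ι n = + n ℚ./ 1

0≤ι : ∀ n → 0ℚ ℚ.≤ ι n
0≤ι n = fromℕ-mono-≤ {0} {n} z≤n

toℚᵘ-ι : ∀ n → ℚ.toℚᵘ (ι n) ℚᵘ.≃ ℚᵘ.mkℚᵘ (+ n) 0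
toℚᵘ-ι n = ℚ.toℚᵘ-fromℚᵘ (ℚᵘ.mkℚᵘ (+ n) 0)

ι-+ : ∀ m n → ι (m ℕ.+ n) ≡ ι m ℚ.+ ι n
ι-+ m n = ℚ.toℚᵘ-injective
  (ℚᵘ.≃-trans (toℚᵘ-ι (m ℕ.+ n))
    (ℚᵘ.≃-trans (ℚᵘ.*≡* (cong (ℤ._* + 1) (sym (cong₂ ℤ._+_ (ℤ.*-identityʳ (+ m)) (ℤ.*-identityʳ (+ n))))))
      (ℚᵘ.≃-sym (ℚᵘ.≃-trans (ℚ.toℚᵘ-homo-+ (ι m) (ι n)) (ℚᵘ.+-cong (toℚᵘ-ι m) (toℚᵘ-ι n))))))

-- The absolute value of the numerator serves, since the denominator is at least 1.
archimedean : ∀ p → ∃ λ n → p ℚ.≤ ι n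
archimedean p@(ℚ.mkℚ _ _ _) = n , ℚ.toℚᵘ-cancel-≤ (ℚᵘ.≤-respʳ-≃ (ℚᵘ.≃-sym (toℚᵘ-ι n)) (ℚᵘ.*≤* (bound (ℚ.↥ p) (ℚ.↧ₙ p))))
  where
  n : ℕ
  n = ℤ.∣ ℚ.↥ p ∣
  bound : ∀ a d .{{_ : ℕ.NonZero d}} → a ℤ.* + 1 ℤ.≤ + ℤ.∣ a ∣ ℤ.* + d
  bound (+ a)    d = subst₂ ℤ._≤_ (sym (ℤ.*-identityʳ (+ a))) (ℤ.pos-* a d) (ℤ.+≤+ (ℕ.m≤m*n a d))
  bound -[1+ a ] d = subst (ℤ._≤ + suc a ℤ.* + d) (sym (ℤ.*-identityʳ -[1+ a ]))
    (subst (-[1+ a ] ℤ.≤_) (ℤ.pos-* (suc a) d) ℤ.-≤+)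

-- Finite rational sums over lists

∑ℚ : {A : Set} → List A → (A → ℚ) → ℚ
∑ℚ []       f = 0ℚ
∑ℚ (x ∷ xs) f = f x ℚ.+ ∑ℚ xs f

seq-∑ : ∀ {A : Set} (xs : List A) (f : A → ℝ) i → seq (∑ xs f) i ≡ ∑ℚ xs (λ x → seq (f x) i)
seq-∑ []       f i = refl
seq-∑ (x ∷ xs) f i = cong (seq (f x) i ℚ.+_) (seq-∑ xs f i)

∑ℚ-cong-∈ : ∀ {A : Set} (xs : List A) {f g : A → ℚ} → (∀ x → x ∈ xs → f x ≡ g x) → ∑ℚ xs f ≡ ∑ℚ xs g
∑ℚ-cong-∈ []       f≡g = refl
∑ℚ-cong-∈ (x ∷ xs) f≡g = cong₂ ℚ._+_ (f≡g x (here refl)) (∑ℚ-cong-∈ xs (λ y y∈ → f≡g y (there y∈)))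

∑ℚ-cong : ∀ {A : Set} (xs : List A) {f g : A → ℚ} → (∀ x → f x ≡ g x) → ∑ℚ xs f ≡ ∑ℚ xs g
∑ℚ-cong xs f≡g = ∑ℚ-cong-∈ xs (λ x _ → f≡g x)

∑ℚ-mono : ∀ {A : Set} (xs : List A) {f g : A → ℚ} → (∀ x → f x ℚ.≤ g x) → ∑ℚ xs f ℚ.≤ ∑ℚ xs g
∑ℚ-mono []       f≤g = ℚ.≤-refl
∑ℚ-mono (x ∷ xs) f≤g = ℚ.+-mono-≤ (f≤g x) (∑ℚ-mono xs f≤g)

∑ℚ-nonneg : ∀ {A : Set} (xs : List A) {f : A → ℚ} → (∀ x → x ∈ xs → 0ℚ ℚ.≤ f x) → 0ℚ ℚ.≤ ∑ℚ xs f
∑ℚ-nonneg []       0≤f = ℚ.≤-refl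
∑ℚ-nonneg (x ∷ xs) 0≤f = +-nonneg (0≤f x (here refl)) (∑ℚ-nonneg xs (λ y y∈ → 0≤f y (there y∈)))

term≤∑ℚ : ∀ {A : Set} (xs : List A) {f : A → ℚ} → (∀ x → x ∈ xs → 0ℚ ℚ.≤ f x) → ∀ {x} → x ∈ xs → f x ℚ.≤ ∑ℚ xs f
term≤∑ℚ (x ∷ xs) {f} 0≤f (here refl) = p≤p+q (f x) (∑ℚ-nonneg xs (λ y y∈ → 0≤f y (there y∈)))
term≤∑ℚ (x ∷ xs) {f} 0≤f {y} (there y∈) = ℚ.≤-trans (term≤∑ℚ xs (λ y y∈ → 0≤f y (there y∈)) y∈)
  (subst (∑ℚ xs f ℚ.≤_) (ℚ.+-comm (∑ℚ xs f) (f x)) (p≤p+q (∑ℚ xs f) (0≤f x (here refl))))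

∑ℚ-++ : ∀ {A : Set} (xs ys : List A) (f : A → ℚ) → ∑ℚ (xs ++ ys) f ≡ ∑ℚ xs f ℚ.+ ∑ℚ ys f
∑ℚ-++ []       ys f = sym (ℚ.+-identityˡ _)
∑ℚ-++ (x ∷ xs) ys f = trans (cong (f x ℚ.+_) (∑ℚ-++ xs ys f)) (sym (ℚ.+-assoc (f x) (∑ℚ xs f) (∑ℚ ys f)))

∑ℚ-map : ∀ {A B : Set} (g : A → B) (xs : List A) (f : B → ℚ) → ∑ℚ (List.map g xs) f ≡ ∑ℚ xs (f ∘ g)
∑ℚ-map g []       f = refl
∑ℚ-map g (x ∷ xs) f = cong (f (g x) ℚ.+_) (∑ℚ-map g xs f)

∑ℚ-concatMap : ∀ {A B : Set} (g : A → List B) (xs : List A) (f : B → ℚ) →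
               ∑ℚ (concatMap g xs) f ≡ ∑ℚ xs (λ x → ∑ℚ (g x) f)
∑ℚ-concatMap g []       f = refl
∑ℚ-concatMap g (x ∷ xs) f = trans (∑ℚ-++ (g x) (concatMap g xs) f) (cong (∑ℚ (g x) f ℚ.+_) (∑ℚ-concatMap g xs f))

∑ℚ-zero : ∀ {A : Set} (xs : List A) → ∑ℚ xs (λ _ → 0ℚ) ≡ 0ℚ
∑ℚ-zero []       = refl
∑ℚ-zero (x ∷ xs) = cong (0ℚ ℚ.+_) (∑ℚ-zero xs)

interchange : ∀ a b c d → (a ℚ.+ b) ℚ.+ (c ℚ.+ d) ≡ (a ℚ.+ c) ℚ.+ (b ℚ.+ d)
interchange = solve 4 (λ a b c d → (a :+ b) :+ (c :+ d) := (a :+ c) :+ (b :+ d)) refl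

∑ℚ-+ : ∀ {A : Set} (xs : List A) (f g : A → ℚ) → ∑ℚ xs (λ x → f x ℚ.+ g x) ≡ ∑ℚ xs f ℚ.+ ∑ℚ xs g
∑ℚ-+ []       f g = refl
∑ℚ-+ (x ∷ xs) f g = trans (cong (f x ℚ.+ g x ℚ.+_) (∑ℚ-+ xs f g)) (interchange (f x) (g x) (∑ℚ xs f) (∑ℚ xs g))

∑ℚ-* : ∀ {A : Set} (xs : List A) c (f : A → ℚ) → ∑ℚ xs (λ x → c ℚ.* f x) ≡ c ℚ.* ∑ℚ xs f
∑ℚ-* []       c f = sym (ℚ.*-zeroʳ c)
∑ℚ-* (x ∷ xs) c f = trans (cong (c ℚ.* f x ℚ.+_) (∑ℚ-* xs c f)) (sym (ℚ.*-distribˡ-+ c (f x) (∑ℚ xs f)))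

∑ℚ-neg : ∀ {A : Set} (xs : List A) (f : A → ℚ) → ∑ℚ xs (λ x → ℚ.- f x) ≡ ℚ.- ∑ℚ xs f
∑ℚ-neg []       f = refl
∑ℚ-neg (x ∷ xs) f = trans (cong (ℚ.- f x ℚ.+_) (∑ℚ-neg xs f)) (sym (ℚ.neg-distrib-+ (f x) (∑ℚ xs f)))

∑ℚ-- : ∀ {A : Set} (xs : List A) (f g : A → ℚ) → ∑ℚ xs (λ x → f x ℚ.- g x) ≡ ∑ℚ xs f ℚ.- ∑ℚ xs g
∑ℚ-- xs f g = trans (∑ℚ-+ xs f (λ x → ℚ.- g x)) (cong (∑ℚ xs f ℚ.+_) (∑ℚ-neg xs g))

∑ℚ-swap : ∀ {A B : Set} (xs : List A) (ys : List B) (f : A → B → ℚ) →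
          ∑ℚ xs (λ x → ∑ℚ ys (f x)) ≡ ∑ℚ ys (λ y → ∑ℚ xs (λ x → f x y))
∑ℚ-swap []       ys f = sym (∑ℚ-zero ys)
∑ℚ-swap (x ∷ xs) ys f = trans (cong (∑ℚ ys (f x) ℚ.+_) (∑ℚ-swap xs ys f)) (sym (∑ℚ-+ ys (f x) (λ y → ∑ℚ xs (λ x → f x y))))

-- Lets the constraint k₁ ≥ 2 be dropped in (ii): the compositions it removes have k₁ = 1, where the
-- weight k₁ - 1 is zero.
∑ℚ-filter : ∀ {A : Set} {P : A → Set} (P? : Decidable P) (xs : List A) {f : A → ℚ} →
            (∀ x → x ∈ xs → ¬ P x → f x ≡ 0ℚ) → ∑ℚ (filter P? xs) f ≡ ∑ℚ xs f
∑ℚ-filter P? []       f≡0 = refl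
∑ℚ-filter P? (x ∷ xs) {f} f≡0 with P? x
... | yes _  = cong (f x ℚ.+_) (∑ℚ-filter P? xs (λ y y∈ → f≡0 y (there y∈)))
... | no ¬Px = trans (∑ℚ-filter P? xs (λ y y∈ → f≡0 y (there y∈)))
  (sym (trans (cong (ℚ._+ ∑ℚ xs f) (f≡0 x (here refl) ¬Px)) (ℚ.+-identityˡ (∑ℚ xs f))))

∑ℚ-upTo-∷ : ∀ n (f : ℕ → ℚ) → ∑ℚ (upTo (suc n)) f ≡ f 0 ℚ.+ ∑ℚ (upTo n) (f ∘ suc)
∑ℚ-upTo-∷ n f = cong (f 0 ℚ.+_)
  (trans (cong (λ xs → ∑ℚ xs f) (sym (List.map-upTo suc n))) (∑ℚ-map suc (upTo n) f))

∑ℚ-upTo-∷ʳ : ∀ n (f : ℕ → ℚ) → ∑ℚ (upTo (suc n)) f ≡ ∑ℚ (upTo n) f ℚ.+ f n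
∑ℚ-upTo-∷ʳ n f = trans (cong (λ xs → ∑ℚ xs f) (sym (List.upTo-∷ʳ n)))
  (trans (∑ℚ-++ (upTo n) (n ∷ []) f) (cong (∑ℚ (upTo n) f ℚ.+_) (ℚ.+-identityʳ (f n))))

∑ℚ-upTo-mono : ∀ {m n} {f : ℕ → ℚ} → (∀ i → 0ℚ ℚ.≤ f i) → m ℕ.≤ n → ∑ℚ (upTo m) f ℚ.≤ ∑ℚ (upTo n) f
∑ℚ-upTo-mono {f = f} 0≤f m≤n = go (ℕ.≤⇒≤′ m≤n)
  where
  go : ∀ {m n} → m ℕ.≤′ n → ∑ℚ (upTo m) f ℚ.≤ ∑ℚ (upTo n) f
  go ℕ.≤′-refl = ℚ.≤-refl
  go {m} {suc n} (ℕ.≤′-step m≤n) = ℚ.≤-trans (go m≤n)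
    (subst (∑ℚ (upTo n) f ℚ.≤_) (sym (∑ℚ-upTo-∷ʳ n f)) (p≤p+q (∑ℚ (upTo n) f) (0≤f n)))

-- The reciprocals 1/(n + v)

1/[_+_] : ℕ → (v : ℚ) → {{0ℚ ℚ.< v}} → ℚ
1/[ n + v ] {{0<v}} = (ℚ.1/ (ι n ℚ.+ v)) {{ℚ.>-nonZero (ℚ.+-mono-≤-< (0≤ι n) 0<v)}}

module _ {v : ℚ} {{0<v : 0ℚ ℚ.< v}} where

  0<n+v : ∀ n → 0ℚ ℚ.< ι n ℚ.+ v
  0<n+v n = ℚ.+-mono-≤-< (0≤ι n) 0<v

  n+v≢0 : ∀ n → ℚ.NonZero (ι n ℚ.+ v)
  n+v≢0 n = ℚ.>-nonZero (0<n+v n)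

  1/[]-inverse : ∀ n → (ι n ℚ.+ v) ℚ.* 1/[ n + v ] ≡ 1ℚ
  1/[]-inverse n = ℚ.*-inverseʳ (ι n ℚ.+ v) {{n+v≢0 n}}

  1/[]-pos : ∀ n → 0ℚ ℚ.< 1/[ n + v ]
  1/[]-pos n = 0<1/ (ι n ℚ.+ v) {{n+v≢0 n}} (0<n+v n)

  -- The denominators differ by 1: adding and subtracting a x y leaves the factors (1 + a) y and a
  -- x, both equal to 1.
  1/[]-step : ∀ n → 1/[ n + v ] ℚ.* 1/[ suc n + v ] ≡ 1/[ n + v ] ℚ.- 1/[ suc n + v ]
  1/[]-step n = begin
    x ℚ.* y                                       ≡⟨ expand a x y ⟩
    x ℚ.* ((1ℚ ℚ.+ a) ℚ.* y) ℚ.- (a ℚ.* x) ℚ.* y  ≡⟨ cong₂ (λ s t → x ℚ.* s ℚ.- t ℚ.* y) inverse-y (1/[]-inverse n) ⟩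
    x ℚ.* 1ℚ ℚ.- 1ℚ ℚ.* y                         ≡⟨ cong₂ ℚ._-_ (ℚ.*-identityʳ x) (ℚ.*-identityˡ y) ⟩
    x ℚ.- y                                       ∎
    where
    open ≡-Reasoning
    a x y : ℚ
    a = ι n ℚ.+ v
    x = 1/[ n + v ]
    y = 1/[ suc n + v ]
    expand : ∀ a x y → x ℚ.* y ≡ x ℚ.* ((1ℚ ℚ.+ a) ℚ.* y) ℚ.- (a ℚ.* x) ℚ.* y
    expand = solve 3 (λ a x y → x :* y := x :* ((con 1ℚ :+ a) :* y) :- (a :* x) :* y) refl
    inverse-y : (1ℚ ℚ.+ a) ℚ.* y ≡ 1ℚ
    inverse-y = trans (cong (ℚ._* y) (trans (sym (ℚ.+-assoc 1ℚ (ι n) v)) (cong (ℚ._+ v) (sym (ι-+ 1 n)))))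
      (1/[]-inverse (suc n))

instance
  0<1ℚ : 0ℚ ℚ.< 1ℚ
  0<1ℚ = ℚ.positive⁻¹ 1ℚ

-- This majorant of 1/(n + 1 + v) is free of v, so every bound in terms of `w` is uniform in u.
w : ℕ → ℚ
w n = 1/[ n + 1ℚ ]

1/[]≤w : ∀ {v} {{0<v : 0ℚ ℚ.< v}} n → 1/[ suc n + v ] ℚ.≤ w n
1/[]≤w {v} {{0<v}} n = 1/-antimono (ι n ℚ.+ 1ℚ) (ι (suc n) ℚ.+ v)
  {{n+v≢0 n}} {{n+v≢0 (suc n)}} (0<n+v n)
  (subst (ℚ._≤ ι (suc n) ℚ.+ v) (trans (ι-+ 1 n) (ℚ.+-comm 1ℚ (ι n))) (p≤p+q (ι (suc n)) (ℚ.<⇒≤ 0<v)))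

w≤1 : ∀ n → w n ℚ.≤ 1ℚ
w≤1 n = 1/-antimono 1ℚ (ι n ℚ.+ 1ℚ) {{_}} {{n+v≢0 n}} 0<1ℚ (ℚ.+-monoˡ-≤ 1ℚ (0≤ι n))

-- Convolution with the powers of a number

-- conv a P K = Σ_{k + j = K, k ≥ 1} aᵏ P(j)
conv : ℚ → (ℕ → ℚ) → ℕ → ℚ
conv a P zero    = 0ℚ
conv a P (suc K) = a ℚ.* (P K ℚ.+ conv a P K)

conv-cong : ∀ a {P Q} → (∀ j → P j ≡ Q j) → ∀ K → conv a P K ≡ conv a Q K
conv-cong a P≡Q zero    = refl
conv-cong a P≡Q (suc K) = cong (a ℚ.*_) (cong₂ ℚ._+_ (P≡Q K) (conv-cong a P≡Q K))

conv-+ : ∀ a P Q K → conv a (λ j → P j ℚ.+ Q j) K ≡ conv a P K ℚ.+ conv a Q K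
conv-+ a P Q zero    = refl
conv-+ a P Q (suc K) = trans
  (cong (a ℚ.*_) (trans (cong (P K ℚ.+ Q K ℚ.+_) (conv-+ a P Q K)) (interchange (P K) (Q K) (conv a P K) (conv a Q K))))
  (ℚ.*-distribˡ-+ a (P K ℚ.+ conv a P K) (Q K ℚ.+ conv a Q K))

conv-vanishes : ∀ a {P} n → (∀ j → j ℕ.< n → P j ≡ 0ℚ) → ∀ K → K ℕ.≤ n → conv a P K ≡ 0ℚ
conv-vanishes a n P≡0 zero    K≤n = refl
conv-vanishes a n P≡0 (suc K) K≤n = trans
  (cong (a ℚ.*_) (cong₂ ℚ._+_ (P≡0 K K≤n) (conv-vanishes a n P≡0 K (ℕ.<⇒≤ K≤n)))) (ℚ.*-zeroʳ a)

conv-nonneg : ∀ {a P} → 0ℚ ℚ.≤ a → (∀ j → 0ℚ ℚ.≤ P j) → ∀ K → 0ℚ ℚ.≤ conv a P K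
conv-nonneg 0≤a 0≤P zero    = ℚ.≤-refl
conv-nonneg 0≤a 0≤P (suc K) = *-nonneg 0≤a (+-nonneg (0≤P K) (conv-nonneg 0≤a 0≤P K))

conv-mono : ∀ {a b P} → 0ℚ ℚ.≤ b → b ℚ.≤ a → (∀ j → 0ℚ ℚ.≤ P j) → ∀ K → conv b P K ℚ.≤ conv a P K
conv-mono 0≤b b≤a 0≤P zero    = ℚ.≤-refl
conv-mono {a} {b} {P} 0≤b b≤a 0≤P (suc K) = *-mono-≤ b a (P K ℚ.+ conv b P K) (P K ℚ.+ conv a P K)
  (+-nonneg (0≤P K) (conv-nonneg 0≤b 0≤P K)) (ℚ.≤-trans 0≤b b≤a) b≤a (ℚ.+-monoʳ-≤ (P K) (conv-mono 0≤b b≤a 0≤P K))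

-- There are K terms aᵏ P(j), and aᵏ ≤ u because k ≥ 1 and u ≤ 1. The single factor u that is kept
-- later becomes the 1/(t + 1) of a Cesàro mean.
conv-bound : ∀ {a u P B} c → 0ℚ ℚ.≤ a → a ℚ.≤ u → u ℚ.≤ 1ℚ → (∀ j → 0ℚ ℚ.≤ P j) →
             (∀ j → j ℕ.≤ c → P j ℚ.≤ B) → ∀ K → K ℕ.≤ c → conv a P K ℚ.≤ ι c ℚ.* (u ℚ.* B)
conv-bound {a} {u} {P} {B} c 0≤a a≤u u≤1 0≤P P≤B K K≤c = ℚ.≤-trans (go K K≤c)
  (ℚ.*-monoʳ-≤-nonNeg (u ℚ.* B) {{ℚ.nonNegative 0≤uB}} (fromℕ-mono-≤ K≤c))
  where
  0≤u : 0ℚ ℚ.≤ u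
  0≤u = ℚ.≤-trans 0≤a a≤u
  0≤uB : 0ℚ ℚ.≤ u ℚ.* B
  0≤uB = *-nonneg 0≤u (ℚ.≤-trans (0≤P 0) (P≤B 0 z≤n))
  go : ∀ K → K ℕ.≤ c → conv a P K ℚ.≤ ι K ℚ.* (u ℚ.* B)
  go zero    _   = ℚ.≤-reflexive (sym (ℚ.*-zeroˡ (u ℚ.* B)))
  go (suc K) K<c = begin
    a ℚ.* (P K ℚ.+ conv a P K)            ≤⟨ *-mono-≤ a u _ _ (+-nonneg (0≤P K) (conv-nonneg 0≤a 0≤P K)) 0≤u a≤u
                                               (ℚ.+-mono-≤ (P≤B K (ℕ.<⇒≤ K<c)) (go K (ℕ.<⇒≤ K<c))) ⟩
    u ℚ.* (B ℚ.+ ι K ℚ.* (u ℚ.* B))       ≡⟨ rearrange u B (ι K) ⟩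
    u ℚ.* B ℚ.+ u ℚ.* (ι K ℚ.* (u ℚ.* B)) ≤⟨ ℚ.+-monoʳ-≤ (u ℚ.* B) (ℚ.*-monoʳ-≤-nonNeg _
                                               {{ℚ.nonNegative (*-nonneg (0≤ι K) 0≤uB)}} u≤1) ⟩
    u ℚ.* B ℚ.+ 1ℚ ℚ.* (ι K ℚ.* (u ℚ.* B)) ≡⟨ collect (u ℚ.* B) (ι K) ⟩
    (1ℚ ℚ.+ ι K) ℚ.* (u ℚ.* B)            ≡⟨ cong (ℚ._* (u ℚ.* B)) (sym (ι-+ 1 K)) ⟩
    ι (suc K) ℚ.* (u ℚ.* B)               ∎
    where
    open ℚ.≤-Reasoning
    rearrange : ∀ u B k → u ℚ.* (B ℚ.+ k ℚ.* (u ℚ.* B)) ≡ u ℚ.* B ℚ.+ u ℚ.* (k ℚ.* (u ℚ.* B))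
    rearrange = solve 3 (λ u B k → u :* (B :+ k :* (u :* B)) := u :* B :+ u :* (k :* (u :* B))) refl
    collect : ∀ q k → q ℚ.+ 1ℚ ℚ.* (k ℚ.* q) ≡ (1ℚ ℚ.+ k) ℚ.* q
    collect = solve 2 (λ q k → q :+ con 1ℚ :* (k :* q) := (con 1ℚ :+ k) :* q) refl

-- In generating functions, `conv a` is multiplication by az/(1 - az). The product of the factors
-- for a and b is z times their difference when ab = a - b, so the weight drops by one and a = x(n₁
-- - 1) is separated from b = x(n₁).
conv-telescope : ∀ a b P → a ℚ.* b ≡ a ℚ.- b → ∀ K → conv a (conv b P) (suc K) ≡ conv a P K ℚ.- conv b P K
conv-telescope a b P ab≡a-b zero    = ℚ.*-zeroʳ a
conv-telescope a b P ab≡a-b (suc K) = begin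
  a ℚ.* (b ℚ.* (p ℚ.+ v) ℚ.+ conv a (conv b P) (suc K)) ≡⟨ cong (λ t → a ℚ.* (b ℚ.* (p ℚ.+ v) ℚ.+ t)) (conv-telescope a b P ab≡a-b K) ⟩
  a ℚ.* (b ℚ.* (p ℚ.+ v) ℚ.+ (u ℚ.- v))                 ≡⟨ expand a b p u v ⟩
  (a ℚ.* b) ℚ.* (p ℚ.+ v) ℚ.+ a ℚ.* (u ℚ.- v)           ≡⟨ cong (λ t → t ℚ.* (p ℚ.+ v) ℚ.+ a ℚ.* (u ℚ.- v)) ab≡a-b ⟩
  (a ℚ.- b) ℚ.* (p ℚ.+ v) ℚ.+ a ℚ.* (u ℚ.- v)           ≡⟨ regroup a b p u v ⟩
  a ℚ.* (p ℚ.+ u) ℚ.- b ℚ.* (p ℚ.+ v)                   ∎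
  where
  open ≡-Reasoning
  p u v : ℚ
  p = P K
  u = conv a P K
  v = conv b P K
  expand : ∀ a b p u v → a ℚ.* (b ℚ.* (p ℚ.+ v) ℚ.+ (u ℚ.- v)) ≡ (a ℚ.* b) ℚ.* (p ℚ.+ v) ℚ.+ a ℚ.* (u ℚ.- v)
  expand = solve 5 (λ a b p u v → a :* (b :* (p :+ v) :+ (u :- v)) := (a :* b) :* (p :+ v) :+ a :* (u :- v)) refl
  regroup : ∀ a b p u v → (a ℚ.- b) ℚ.* (p ℚ.+ v) ℚ.+ a ℚ.* (u ℚ.- v) ≡ a ℚ.* (p ℚ.+ u) ℚ.- b ℚ.* (p ℚ.+ v)
  regroup = solve 5 (λ a b p u v → (a :- b) :* (p :+ v) :+ a :* (u :- v) := a :* (p :+ u) :- b :* (p :+ v)) refl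

-- `conv` is this sum in Horner form: the term k = 1 is split off and a factor a is taken out of the
-- others.
∑-upTo≡conv : ∀ a P K → ∑ℚ (upTo K) (λ i → a ^ suc i ℚ.* P (K ℕ.∸ suc i)) ≡ conv a P K
∑-upTo≡conv a P zero    = refl
∑-upTo≡conv a P (suc K) = begin
  ∑ℚ (upTo (suc K)) (λ i → a ^ suc i ℚ.* P (K ℕ.∸ i))                          ≡⟨ ∑ℚ-upTo-∷ K (λ i → a ^ suc i ℚ.* P (K ℕ.∸ i)) ⟩
  (a ℚ.* 1ℚ) ℚ.* P K ℚ.+ ∑ℚ (upTo K) (λ i → (a ℚ.* a ^ suc i) ℚ.* P (K ℕ.∸ suc i))
    ≡⟨ cong₂ ℚ._+_ (cong (ℚ._* P K) (ℚ.*-identityʳ a)) (trans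
         (∑ℚ-cong (upTo K) (λ i → ℚ.*-assoc a (a ^ suc i) (P (K ℕ.∸ suc i)))) (∑ℚ-* (upTo K) a _)) ⟩
  a ℚ.* P K ℚ.+ a ℚ.* ∑ℚ (upTo K) (λ i → a ^ suc i ℚ.* P (K ℕ.∸ suc i))
    ≡⟨ cong (λ s → a ℚ.* P K ℚ.+ a ℚ.* s) (∑-upTo≡conv a P K) ⟩
  a ℚ.* P K ℚ.+ a ℚ.* conv a P K                                               ≡⟨ sym (ℚ.*-distribˡ-+ a (P K) (conv a P K)) ⟩
  a ℚ.* (P K ℚ.+ conv a P K)                                                   ∎
  where open ≡-Reasoning

-- There are i pairs (k₀ , k₁) of positive integers with k₀ + k₁ = suc i.
∑-upTo-weighted≡conv-conv : ∀ b P K →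
  ∑ℚ (upTo K) (λ i → ι i ℚ.* (b ^ suc i ℚ.* P (K ℕ.∸ suc i))) ≡ conv b (conv b P) K
∑-upTo-weighted≡conv-conv b P zero    = refl
∑-upTo-weighted≡conv-conv b P (suc K) = begin
  ∑ℚ (upTo (suc K)) (λ i → ι i ℚ.* (b ^ suc i ℚ.* P (K ℕ.∸ i)))
    ≡⟨ ∑ℚ-upTo-∷ K (λ i → ι i ℚ.* (b ^ suc i ℚ.* P (K ℕ.∸ i))) ⟩
  0ℚ ℚ.* (b ^ 1 ℚ.* P K) ℚ.+ ∑ℚ (upTo K) (λ i → ι (suc i) ℚ.* ((b ℚ.* b ^ suc i) ℚ.* P (K ℕ.∸ suc i)))
    ≡⟨ cong₂ ℚ._+_ (ℚ.*-zeroˡ (b ^ 1 ℚ.* P K)) (∑ℚ-cong (upTo K) (λ i →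
         trans (cong (ℚ._* ((b ℚ.* b ^ suc i) ℚ.* P (K ℕ.∸ suc i))) (ι-+ 1 i)) (expand (ι i) b (b ^ suc i) (P (K ℕ.∸ suc i))))) ⟩
  0ℚ ℚ.+ ∑ℚ (upTo K) (λ i → b ℚ.* (f i ℚ.+ ι i ℚ.* f i))
    ≡⟨ trans (ℚ.+-identityˡ _) (trans (∑ℚ-* (upTo K) b _) (cong (b ℚ.*_) (∑ℚ-+ (upTo K) f (λ i → ι i ℚ.* f i)))) ⟩
  b ℚ.* (∑ℚ (upTo K) f ℚ.+ ∑ℚ (upTo K) (λ i → ι i ℚ.* f i))
    ≡⟨ cong (b ℚ.*_) (cong₂ ℚ._+_ (∑-upTo≡conv b P K) (∑-upTo-weighted≡conv-conv b P K)) ⟩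
  b ℚ.* (conv b P K ℚ.+ conv b (conv b P) K) ∎
  where
  open ≡-Reasoning
  f : ℕ → ℚ
  f i = b ^ suc i ℚ.* P (K ℕ.∸ suc i)
  expand : ∀ k b c p → (1ℚ ℚ.+ k) ℚ.* ((b ℚ.* c) ℚ.* p) ≡ b ℚ.* (c ℚ.* p ℚ.+ k ℚ.* (c ℚ.* p))
  expand = solve 4 (λ k b c p → (con 1ℚ :+ k) :* ((b :* c) :* p) := b :* (c :* p :+ k :* (c :* p))) refl

-- Sums over compositions and chains

∑-compositions-∷ : ∀ r K (f : Vec ℕ (suc r) → ℚ) → ∑ℚ (compositionsℕ (suc r) K) f ≡
  ∑ℚ (upTo K) (λ i → ∑ℚ (compositionsℕ r (K ℕ.∸ suc i)) (λ ks → f (suc i ∷ ks)))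
∑-compositions-∷ r K f = trans (∑ℚ-concatMap _ (upTo K) f) (∑ℚ-cong (upTo K) (λ i → ∑ℚ-map (suc i ∷_) (compositionsℕ r (K ℕ.∸ suc i)) f))

∑-compositions≡conv : ∀ r K a (g : Vec ℕ r → ℚ) →
  ∑ℚ (compositionsℕ (suc r) K) (λ k → a ^ head k ℚ.* g (tail k)) ≡ conv a (λ j → ∑ℚ (compositionsℕ r j) g) K
∑-compositions≡conv r K a g = trans (∑-compositions-∷ r K _)
  (trans (∑ℚ-cong (upTo K) (λ i → ∑ℚ-* (compositionsℕ r (K ℕ.∸ suc i)) (a ^ suc i) g)) (∑-upTo≡conv a _ K))

∑-compositions-weighted≡conv-conv : ∀ r K b (g : Vec ℕ r → ℚ) →
  ∑ℚ (compositionsℕ (suc r) K) (λ k → (ι (head k) ℚ.- 1ℚ) ℚ.* (b ^ head k ℚ.* g (tail k)))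
    ≡ conv b (conv b (λ j → ∑ℚ (compositionsℕ r j) g)) K
∑-compositions-weighted≡conv-conv r K b g = trans (∑-compositions-∷ r K _)
  (trans (∑ℚ-cong (upTo K) (λ i → trans (∑ℚ-* (compositionsℕ r (K ℕ.∸ suc i)) (ι (suc i) ℚ.- 1ℚ) _)
      (cong₂ ℚ._*_ (trans (cong (ℚ._- 1ℚ) (ι-+ 1 i)) (ring₃ 1ℚ (ι i)))
        (∑ℚ-* (compositionsℕ r (K ℕ.∸ suc i)) (b ^ suc i) g))))
    (∑-upTo-weighted≡conv-conv b _ K))

-- Collects all that is needed of x(n) = 1/(n + u). What holds for every such x is uniform in u, so
-- u may be replaced by its rational approximations, one at each index.
record Telescoping (x : ℕ → ℚ) : Set where
  field
    pos  : ∀ n → 0ℚ ℚ.< x n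
    step : ∀ n → x n ℚ.* x (suc n) ≡ x n ℚ.- x (suc n)
    ≤w   : ∀ n → x (suc n) ℚ.≤ w n

  nonneg : ∀ n → 0ℚ ℚ.≤ x n
  nonneg n = ℚ.<⇒≤ (pos n)

  0<step : ∀ n → 0ℚ ℚ.< x n ℚ.- x (suc n)
  0<step n = subst (0ℚ ℚ.<_) (step n) (0<* (x n) (x (suc n)) (pos n) (pos (suc n)))

  decreasing : ∀ n → x (suc n) ℚ.≤ x n
  decreasing n = 0≤q-p⇒p≤q (ℚ.<⇒≤ (0<step n))

1/[]-telescoping : ∀ v {{0<v : 0ℚ ℚ.< v}} → Telescoping (λ n → 1/[ n + v ])
1/[]-telescoping v = record { pos = 1/[]-pos ; step = 1/[]-step ; ≤w = 1/[]≤w }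

-- Σ_{t ≥ n₁ ≥ ⋯ ≥ nᵣ ≥ 1} x(n₁)^k₁ ⋯ x(nᵣ)^kᵣ, with n₁ written as suc i for i < t
chainSum : (ℕ → ℚ) → ∀ {r} → Vec ℕ r → ℕ → ℚ
chainSum x []       t = 1ℚ
chainSum x (k ∷ ks) t = ∑ℚ (upTo t) (λ i → x (suc i) ^ k ℚ.* chainSum x ks (suc i))

-- The chain sums with one more factor x(n₁ - 1)^k₀, as on the left-hand side of (i).
chainSum₀ : (ℕ → ℚ) → ∀ {r} → Vec ℕ (suc (suc r)) → ℕ → ℚ
chainSum₀ x (k₀ ∷ k₁ ∷ ks) t = ∑ℚ (upTo t) (λ i → x i ^ k₀ ℚ.* (x (suc i) ^ k₁ ℚ.* chainSum x ks (suc i)))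

-- The total of chainSum x k t over all compositions k of K into r parts.
D : (ℕ → ℚ) → ℕ → ℕ → ℕ → ℚ
D x zero    t zero    = 1ℚ
D x zero    t (suc K) = 0ℚ
D x (suc r) t K       = ∑ℚ (upTo t) (λ i → conv (x (suc i)) (D x r (suc i)) K)

-- For r ≥ 1 this is the total of `chainSum₀` over the compositions of K into r + 1 parts. For r = 0
-- only k₀ is left and the value is x(0)^K, or 0 when K = 0; the reduction of r ends there.
T : (ℕ → ℚ) → ℕ → ℕ → ℕ → ℚ
T x zero    t K = conv (x 0) (D x 0 t) K
T x (suc r) t K = ∑ℚ (upTo t) (λ i → conv (x i) (conv (x (suc i)) (D x r (suc i))) K)

-- T with x(n₁ - 1) replaced by x(n₁), which merges k₀ and k₁ into k₁ with weight k₁ - 1.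
T′ : (ℕ → ℚ) → ℕ → ℕ → ℕ → ℚ
T′ x r t K = ∑ℚ (upTo t) (λ i → conv (x (suc i)) (conv (x (suc i)) (D x r (suc i))) K)

-- Exchanging the sums puts n₁ outermost. For fixed n₁ the exponent k₁ gives a convolution with the
-- total over the remaining exponents, which is known by induction.
∑-compositions-chainSum : ∀ x r t K → ∑ℚ (compositionsℕ r K) (λ k → chainSum x k t) ≡ D x r t K
∑-compositions-chainSum x zero    t zero    = refl
∑-compositions-chainSum x zero    t (suc K) = refl
∑-compositions-chainSum x (suc r) t K       = begin
  ∑ℚ (compositionsℕ (suc r) K) (λ k → chainSum x k t)
    ≡⟨ ∑ℚ-cong (compositionsℕ (suc r) K) (λ { (k ∷ ks) → refl }) ⟩
  ∑ℚ (compositionsℕ (suc r) K) (λ k → ∑ℚ (upTo t) (λ i → x (suc i) ^ head k ℚ.* chainSum x (tail k) (suc i)))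
    ≡⟨ ∑ℚ-swap (compositionsℕ (suc r) K) (upTo t) _ ⟩
  ∑ℚ (upTo t) (λ i → ∑ℚ (compositionsℕ (suc r) K) (λ k → x (suc i) ^ head k ℚ.* chainSum x (tail k) (suc i)))
    ≡⟨ ∑ℚ-cong (upTo t) (λ i → trans (∑-compositions≡conv r K (x (suc i)) (λ ks → chainSum x ks (suc i)))
         (conv-cong (x (suc i)) (∑-compositions-chainSum x r (suc i)) K)) ⟩
  D x (suc r) t K ∎
  where open ≡-Reasoning

∑-compositions-chainSum₀ : ∀ x r t K → ∑ℚ (compositionsℕ (suc (suc r)) K) (λ k → chainSum₀ x k t) ≡ T x (suc r) t K
∑-compositions-chainSum₀ x r t K = begin
  ∑ℚ (compositionsℕ (suc (suc r)) K) (λ k → chainSum₀ x k t)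
    ≡⟨ ∑ℚ-cong (compositionsℕ (suc (suc r)) K) (λ { (k₀ ∷ k₁ ∷ ks) → refl }) ⟩
  ∑ℚ (compositionsℕ (suc (suc r)) K) (λ k → ∑ℚ (upTo t) (λ i → x i ^ head k ℚ.* g i (tail k)))
    ≡⟨ ∑ℚ-swap (compositionsℕ (suc (suc r)) K) (upTo t) _ ⟩
  ∑ℚ (upTo t) (λ i → ∑ℚ (compositionsℕ (suc (suc r)) K) (λ k → x i ^ head k ℚ.* g i (tail k)))
    ≡⟨ ∑ℚ-cong (upTo t) (λ i → trans (∑-compositions≡conv (suc r) K (x i) (g i))
         (conv-cong (x i) (λ j → trans (∑-compositions≡conv r j (x (suc i)) (λ ks → chainSum x ks (suc i)))
           (conv-cong (x (suc i)) (∑-compositions-chainSum x r (suc i)) j)) K)) ⟩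
  T x (suc r) t K ∎
  where
  open ≡-Reasoning
  g : ℕ → Vec ℕ (suc r) → ℚ
  g i k = x (suc i) ^ head k ℚ.* chainSum x (tail k) (suc i)

∑-compositions-weighted-chainSum : ∀ x r t K →
  ∑ℚ (compositionsℕ (suc r) K) (λ k → (ι (head k) ℚ.- 1ℚ) ℚ.* chainSum x k t) ≡ T′ x r t K
∑-compositions-weighted-chainSum x r t K = begin
  ∑ℚ (compositionsℕ (suc r) K) (λ k → (ι (head k) ℚ.- 1ℚ) ℚ.* chainSum x k t)
    ≡⟨ ∑ℚ-cong (compositionsℕ (suc r) K) (λ { (k ∷ ks) → sym (∑ℚ-* (upTo t) (ι k ℚ.- 1ℚ) _) }) ⟩
  ∑ℚ (compositionsℕ (suc r) K) (λ k → ∑ℚ (upTo t) (λ i → (ι (head k) ℚ.- 1ℚ) ℚ.* (x (suc i) ^ head k ℚ.* chainSum x (tail k) (suc i))))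
    ≡⟨ ∑ℚ-swap (compositionsℕ (suc r) K) (upTo t) _ ⟩
  ∑ℚ (upTo t) (λ i → ∑ℚ (compositionsℕ (suc r) K) (λ k → (ι (head k) ℚ.- 1ℚ) ℚ.* (x (suc i) ^ head k ℚ.* chainSum x (tail k) (suc i))))
    ≡⟨ ∑ℚ-cong (upTo t) (λ i → trans (∑-compositions-weighted≡conv-conv r K (x (suc i)) (λ ks → chainSum x ks (suc i)))
         (conv-cong (x (suc i)) (conv-cong (x (suc i)) (∑-compositions-chainSum x r (suc i))) K)) ⟩
  T′ x r t K ∎
  where open ≡-Reasoning

D₀-constant : ∀ x s t j → D x 0 s j ≡ D x 0 t j
D₀-constant x s t zero    = refl
D₀-constant x s t (suc j) = refl

-- Σ_{n₁} telescopes by conv-telescope; the boundary terms below n₁ = n₂ are collected by Abel summation.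
T-step : ∀ {x} → Telescoping x → ∀ r t K → T x (suc r) t (suc K) ℚ.+ conv (x t) (D x r t) K ≡ T x r t K
T-step {x} tel zero    zero K = ℚ.+-identityˡ (T x 0 0 K)
T-step {x} tel (suc r) zero K = trans (ℚ.+-identityˡ _) (conv-vanishes (x 0) K (λ _ _ → refl) K ℕ.≤-refl)
T-step {x} tel r (suc t) K = trans shift (rest r)
  where
  open ≡-Reasoning
  cancel : ∀ a b c → (a ℚ.+ (b ℚ.- c)) ℚ.+ c ≡ a ℚ.+ b
  cancel = solve 3 (λ a b c → (a :+ (b :- c)) :+ c := a :+ b) refl
  -- The new summand n₁ = t + 1 telescopes to a difference whose negative part cancels the boundary
  -- term.
  shift : T x (suc r) (suc t) (suc K) ℚ.+ conv (x (suc t)) (D x r (suc t)) K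
        ≡ T x (suc r) t (suc K) ℚ.+ conv (x t) (D x r (suc t)) K
  shift = trans
    (cong (ℚ._+ conv (x (suc t)) (D x r (suc t)) K)
      (trans (∑ℚ-upTo-∷ʳ t (λ i → conv (x i) (conv (x (suc i)) (D x r (suc i))) (suc K)))
        (cong (T x (suc r) t (suc K) ℚ.+_)
          (conv-telescope (x t) (x (suc t)) (D x r (suc t)) (Telescoping.step tel t) K))))
    (cancel (T x (suc r) t (suc K)) (conv (x t) (D x r (suc t)) K) (conv (x (suc t)) (D x r (suc t)) K))
  rest : ∀ r → T x (suc r) t (suc K) ℚ.+ conv (x t) (D x r (suc t)) K ≡ T x r (suc t) K
  rest zero = begin
    T x 1 t (suc K) ℚ.+ conv (x t) (D x 0 (suc t)) K ≡⟨ cong (T x 1 t (suc K) ℚ.+_) (conv-cong (x t) (D₀-constant x (suc t) t) K) ⟩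
    T x 1 t (suc K) ℚ.+ conv (x t) (D x 0 t) K       ≡⟨ T-step tel 0 t K ⟩
    conv (x 0) (D x 0 t) K                           ≡⟨ sym (conv-cong (x 0) (D₀-constant x (suc t) t) K) ⟩
    T x 0 (suc t) K                                  ∎
  -- Separating n₂ = t + 1 inside `D` yields exactly the last summand `B` of the right-hand side;
  -- what remains is the case t.
  rest (suc r) = begin
    A ℚ.+ conv (x t) (D x (suc r) (suc t)) K
      ≡⟨ cong (A ℚ.+_) (trans (conv-cong (x t) (λ j → ∑ℚ-upTo-∷ʳ t (λ i → conv (x (suc i)) (D x r (suc i)) j)) K)
           (conv-+ (x t) (D x (suc r) t) (conv (x (suc t)) (D x r (suc t))) K)) ⟩
    A ℚ.+ (conv (x t) (D x (suc r) t) K ℚ.+ B)   ≡⟨ sym (ℚ.+-assoc A (conv (x t) (D x (suc r) t) K) B) ⟩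
    (A ℚ.+ conv (x t) (D x (suc r) t) K) ℚ.+ B   ≡⟨ cong (ℚ._+ B) (T-step tel (suc r) t K) ⟩
    T x (suc r) t K ℚ.+ B                        ≡⟨ sym (∑ℚ-upTo-∷ʳ t (λ i → conv (x i) (conv (x (suc i)) (D x r (suc i))) K)) ⟩
    T x (suc r) (suc t) K                        ∎
    where
    A B : ℚ
    A = T x (suc (suc r)) t (suc K)
    B = conv (x t) (conv (x (suc t)) (D x r (suc t))) K

D-nonneg : ∀ {x} → Telescoping x → ∀ r t K → 0ℚ ℚ.≤ D x r t K
D-nonneg tel zero    t zero    = ℚ.<⇒≤ 0<1ℚ
D-nonneg tel zero    t (suc K) = ℚ.≤-refl
D-nonneg tel (suc r) t K       = ∑ℚ-nonneg (upTo t) (λ i _ →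
  conv-nonneg (Telescoping.nonneg tel (suc i)) (D-nonneg tel r (suc i)) K)

-- The limit of T x r t K as t → ∞.
L : (ℕ → ℚ) → ℕ → ℕ → ℚ
L x zero    K       = conv (x 0) (D x 0 0) K
L x (suc r) zero    = 0ℚ
L x (suc r) (suc K) = L x r K

-- After r reductions the weight d + 1 is left, and the convolution with the unit has x(0)^(d+1) as
-- its only nonzero term.
L-power : ∀ x r d {K} → r ℕ.+ suc d ≡ K → L x r K ≡ x 0 ^ suc d
L-power x zero    zero    refl = cong (x 0 ℚ.*_) (ℚ.+-identityʳ 1ℚ)
L-power x zero    (suc d) refl = cong (x 0 ℚ.*_) (trans (ℚ.+-identityˡ _) (L-power x zero d refl))
L-power x (suc r) d       refl = L-power x r d refl

L-vanishes : ∀ x r K → K ℕ.≤ r → L x r K ≡ 0ℚ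
L-vanishes x zero    zero    _         = refl
L-vanishes x (suc r) zero    _         = refl
L-vanishes x (suc r) (suc K) (s≤s K≤r) = L-vanishes x r K K≤r

T-zero : ∀ x r t → T x (suc r) t 0 ≡ 0ℚ
T-zero x r t = ∑ℚ-zero (upTo t)

-- Every application of `T-step` discards a nonnegative boundary term, so the limit is approached
-- from below.
T≤L : ∀ {x} → Telescoping x → ∀ r t K → T x r t K ℚ.≤ L x r K
T≤L {x} tel zero    t K       = ℚ.≤-reflexive (conv-cong (x 0) (D₀-constant x t 0) K)
T≤L {x} tel (suc r) t zero    = ℚ.≤-reflexive (T-zero x r t)
T≤L {x} tel (suc r) t (suc K) = ℚ.≤-trans
  (subst (T x (suc r) t (suc K) ℚ.≤_) (T-step tel r t K)
    (p≤p+q (T x (suc r) t (suc K)) (conv-nonneg (Telescoping.nonneg tel t) (D-nonneg tel r t) K)))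
  (T≤L tel r t K)

-- Null sequences

Null : (ℕ → ℚ) → Set
Null y = ∀ ε → 0ℚ ℚ.< ε → Eventually λ n → y n ℚ.≤ ε

null-0 : Null (λ _ → 0ℚ)
null-0 ε 0<ε = 0 , λ _ _ → ℚ.<⇒≤ 0<ε

null-+ : ∀ {y z} → Null y → Null z → Null (λ n → y n ℚ.+ z n)
null-+ {y} {z} y→0 z→0 ε 0<ε =
  let (M , hM) = y→0 (½ ℚ.* ε) (0<½ε 0<ε)
      (N , hN) = z→0 (½ ℚ.* ε) (0<½ε 0<ε)
  in M ℕ.⊔ N , λ n hn → subst (y n ℚ.+ z n ℚ.≤_) (½ε+½ε ε)
       (ℚ.+-mono-≤ (hM n (ℕ.m⊔n≤o⇒m≤o M N hn)) (hN n (ℕ.m⊔n≤o⇒n≤o M N hn)))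

null-* : ∀ {y} c → 0ℚ ℚ.≤ c → Null y → Null (λ n → c ℚ.* y n)
null-* {y} c 0≤c y→0 ε 0<ε =
  -- `share` wants positive coefficients and c may be 0, hence c + 1.
  let (η , 0<η , total) = share (c ℚ.+ 1ℚ) 1ℚ ε (ℚ.+-mono-≤-< 0≤c 0<1ℚ) 0<1ℚ 0<ε
      (N , hN)          = y→0 η 0<η
  in N , λ n hn → ℚ.≤-trans (ℚ.*-monoˡ-≤-nonNeg c {{ℚ.nonNegative 0≤c}} (hN n hn))
       (subst (c ℚ.* η ℚ.≤_) (trans (rearrange c η) total)
         (p≤p+q (c ℚ.* η) (+-nonneg (ℚ.<⇒≤ 0<η) (ℚ.<⇒≤ 0<η))))
  where
  rearrange : ∀ c η → c ℚ.* η ℚ.+ (η ℚ.+ η) ≡ (c ℚ.+ 1ℚ) ℚ.* η ℚ.+ 1ℚ ℚ.* η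
  rearrange = solve 2 (λ c η → c :* η :+ (η :+ η) := (c :+ con 1ℚ) :* η :+ con 1ℚ :* η) refl

null-cong : ∀ {y z} → (∀ n → y n ≡ z n) → Null y → Null z
null-cong y≡z y→0 ε 0<ε = let (N , hN) = y→0 ε 0<ε in N , λ n hn → subst (ℚ._≤ ε) (y≡z n) (hN n hn)

-- Any N ≥ B/ε works, since then B ≤ ε (n + 1) for n ≥ N.
null-w : ∀ B → Null (λ n → B ℚ.* w n)
null-w B ε 0<ε = N , λ n N≤n → begin
  B ℚ.* w n                    ≡⟨ cong (ℚ._* w n) (sym (trans (cong (ε ℚ.*_) (ℚ.*-comm B ε⁻¹))
                                    (trans (sym (ℚ.*-assoc ε ε⁻¹ B)) (trans (cong (ℚ._* B) (ℚ.*-inverseʳ ε {{ε≢0}})) (ℚ.*-identityˡ B))))) ⟩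
  (ε ℚ.* (B ℚ.* ε⁻¹)) ℚ.* w n  ≤⟨ ℚ.*-monoʳ-≤-nonNeg (w n) {{ℚ.nonNegative (ℚ.<⇒≤ (1/[]-pos n))}}
                                    (ℚ.*-monoˡ-≤-nonNeg ε {{ℚ.nonNegative (ℚ.<⇒≤ 0<ε)}}
                                      (ℚ.≤-trans B/ε≤N (ℚ.≤-trans (fromℕ-mono-≤ N≤n) (p≤p+q (ι n) (ℚ.<⇒≤ 0<1ℚ))))) ⟩
  (ε ℚ.* (ι n ℚ.+ 1ℚ)) ℚ.* w n ≡⟨ trans (ℚ.*-assoc ε (ι n ℚ.+ 1ℚ) (w n)) (trans (cong (ε ℚ.*_) (1/[]-inverse n)) (ℚ.*-identityʳ ε)) ⟩
  ε                            ∎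
  where
  open ℚ.≤-Reasoning
  ε≢0 : ℚ.NonZero ε
  ε≢0 = ℚ.>-nonZero 0<ε
  ε⁻¹ : ℚ
  ε⁻¹ = (ℚ.1/ ε) {{ε≢0}}
  N : ℕ
  N = proj₁ (archimedean (B ℚ.* ε⁻¹))
  B/ε≤N : B ℚ.* ε⁻¹ ℚ.≤ ι N
  B/ε≤N = proj₂ (archimedean (B ℚ.* ε⁻¹))

-- The terms before index M have a fixed sum B, whose share B/(n + 1) tends to 0; every later term
-- is at most ε/2, and so is their contribution to the mean.
cesàro : ∀ {y} → (∀ n → 0ℚ ℚ.≤ y n) → Null y → Null (λ n → w n ℚ.* ∑ℚ (upTo (suc n)) y)
cesàro {y} 0≤y y→0 ε 0<ε =
  let (M , hM) = y→0 η (0<½ε 0<ε)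
      B        = ∑ℚ (upTo M) y
      (N , hN) = null-w B η (0<½ε 0<ε)
  in N , λ n N≤n → begin
    w n ℚ.* ∑ℚ (upTo (suc n)) y        ≤⟨ ℚ.*-monoˡ-≤-nonNeg (w n) {{ℚ.nonNegative (ℚ.<⇒≤ (1/[]-pos n))}} (bound M hM (suc n)) ⟩
    w n ℚ.* (B ℚ.+ ι (suc n) ℚ.* η)    ≡⟨ cong (λ q → w n ℚ.* (B ℚ.+ q ℚ.* η)) (trans (ι-+ 1 n) (ℚ.+-comm 1ℚ (ι n))) ⟩
    w n ℚ.* (B ℚ.+ (ι n ℚ.+ 1ℚ) ℚ.* η) ≡⟨ expand (w n) B (ι n ℚ.+ 1ℚ) η ⟩
    B ℚ.* w n ℚ.+ ((ι n ℚ.+ 1ℚ) ℚ.* w n) ℚ.* η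
                                       ≡⟨ cong (λ q → B ℚ.* w n ℚ.+ q ℚ.* η) (1/[]-inverse n) ⟩
    B ℚ.* w n ℚ.+ 1ℚ ℚ.* η             ≤⟨ ℚ.+-mono-≤ (hN n N≤n) (ℚ.≤-reflexive (ℚ.*-identityˡ η)) ⟩
    η ℚ.+ η                            ≡⟨ ½ε+½ε ε ⟩
    ε                                  ∎
  where
  open ℚ.≤-Reasoning
  η : ℚ
  η = ½ ℚ.* ε
  0≤η : 0ℚ ℚ.≤ η
  0≤η = ℚ.<⇒≤ (0<½ε 0<ε)
  expand : ∀ w B q η → w ℚ.* (B ℚ.+ q ℚ.* η) ≡ B ℚ.* w ℚ.+ (q ℚ.* w) ℚ.* η
  expand = solve 4 (λ w B q η → w :* (B :+ q :* η) := B :* w :+ (q :* w) :* η) refl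
  collect : ∀ B q η → (B ℚ.+ q ℚ.* η) ℚ.+ η ≡ B ℚ.+ (1ℚ ℚ.+ q) ℚ.* η
  collect = solve 3 (λ B q η → (B :+ q :* η) :+ η := B :+ (con 1ℚ :+ q) :* η) refl
  -- All n terms are charged η, not only the late ones, which avoids counting n - M.
  bound : ∀ M → (∀ n → M ℕ.≤ n → y n ℚ.≤ η) → ∀ n → ∑ℚ (upTo n) y ℚ.≤ ∑ℚ (upTo M) y ℚ.+ ι n ℚ.* η
  bound M hM zero = ℚ.≤-trans (∑ℚ-nonneg (upTo M) (λ i _ → 0≤y i))
    (p≤p+q _ (*-nonneg (0≤ι 0) 0≤η))
  bound M hM (suc n) with ℕ.≤-<-connex M n
  ... | inj₁ M≤n = begin
    ∑ℚ (upTo (suc n)) y                           ≡⟨ ∑ℚ-upTo-∷ʳ n y ⟩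
    ∑ℚ (upTo n) y ℚ.+ y n                         ≤⟨ ℚ.+-mono-≤ (bound M hM n) (hM n M≤n) ⟩
    (∑ℚ (upTo M) y ℚ.+ ι n ℚ.* η) ℚ.+ η           ≡⟨ collect (∑ℚ (upTo M) y) (ι n) η ⟩
    ∑ℚ (upTo M) y ℚ.+ (1ℚ ℚ.+ ι n) ℚ.* η          ≡⟨ cong (λ q → ∑ℚ (upTo M) y ℚ.+ q ℚ.* η) (sym (ι-+ 1 n)) ⟩
    ∑ℚ (upTo M) y ℚ.+ ι (suc n) ℚ.* η             ∎
  ... | inj₂ n<M = ℚ.≤-trans (∑ℚ-upTo-mono 0≤y n<M) (p≤p+q _ (*-nonneg (0≤ι (suc n)) 0≤η))

-- The error in T-step

-- Majorants of D x r t K and of conv (x (suc t)) (D x r (suc t)) K for K ≤ c, uniform in x.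
G   : ℕ → ℕ → ℕ → ℚ
err : ℕ → ℕ → ℕ → ℚ
G c zero    t = 1ℚ
G c (suc r) t = ∑ℚ (upTo t) (err c r)
err c r t = ι c ℚ.* (w t ℚ.* G c r (suc t))

G-nonneg   : ∀ c r t → 0ℚ ℚ.≤ G c r t
err-nonneg : ∀ c r t → 0ℚ ℚ.≤ err c r t
G-nonneg c zero    t = ℚ.<⇒≤ 0<1ℚ
G-nonneg c (suc r) t = ∑ℚ-nonneg (upTo t) (λ i _ → err-nonneg c r i)
err-nonneg c r t = *-nonneg (0≤ι c) (*-nonneg (ℚ.<⇒≤ (1/[]-pos t)) (G-nonneg c r (suc t)))

-- Up to the factor c, `err c (suc r)` is the Cesàro mean of `err c r`; the induction starts at a
-- multiple of 1/(t + 1).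
err-null : ∀ c r → Null (err c r)
err-null c zero    = null-* (ι c) (0≤ι c) (null-cong (λ n → ℚ.*-comm 1ℚ (w n)) (null-w 1ℚ))
err-null c (suc r) = null-* (ι c) (0≤ι c) (cesàro (err-nonneg c r) (err-null c r))

D≤G : ∀ {x} → Telescoping x → ∀ c r t K → K ℕ.≤ c → D x r t K ℚ.≤ G c r t
conv-D≤err : ∀ {x} → Telescoping x → ∀ c r t K → K ℕ.≤ c → conv (x (suc t)) (D x r (suc t)) K ℚ.≤ err c r t
D≤G tel c zero    t zero    K≤c = ℚ.≤-refl
D≤G tel c zero    t (suc K) K≤c = ℚ.<⇒≤ 0<1ℚ
D≤G tel c (suc r) t K       K≤c = ∑ℚ-mono (upTo t) (λ i → conv-D≤err tel c r i K K≤c)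
conv-D≤err tel c r t K K≤c = conv-bound c (Telescoping.nonneg tel (suc t)) (Telescoping.≤w tel t) (w≤1 t)
  (D-nonneg tel r (suc t)) (λ j j≤c → D≤G tel c r (suc t) j j≤c) K K≤c

-- The error is chosen before x, hence is common to all telescoping sequences. Each reduction by
-- `T-step` adds the majorant of its boundary term. The cut-off is `suc t` because `w t` bounds x(t
-- + 1).
T→L : ∀ r K → ∃ λ e → Null e × (∀ {x} → Telescoping x → ∀ t → L x r K ℚ.≤ T x r (suc t) K ℚ.+ e t)
T→L zero K = (λ _ → 0ℚ) , null-0 , λ {x} tel t → ℚ.≤-reflexive
  (sym (trans (ℚ.+-identityʳ _) (conv-cong (x 0) (D₀-constant x (suc t) 0) K)))
T→L (suc r) zero = (λ _ → 0ℚ) , null-0 , λ {x} tel t → ℚ.≤-reflexive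
  (sym (trans (ℚ.+-identityʳ _) (T-zero x r (suc t))))
T→L (suc r) (suc K) with T→L r K
... | e , e→0 , h = (λ t → err K r t ℚ.+ e t) , null-+ (err-null K r) e→0 , λ {x} tel t → begin
  L x r K                                                             ≤⟨ h tel t ⟩
  T x r (suc t) K ℚ.+ e t                                             ≡⟨ cong (ℚ._+ e t) (sym (T-step tel r (suc t) K)) ⟩
  (T x (suc r) (suc t) (suc K) ℚ.+ conv (x (suc t)) (D x r (suc t)) K) ℚ.+ e t
    ≤⟨ ℚ.+-monoˡ-≤ (e t) (ℚ.+-monoʳ-≤ (T x (suc r) (suc t) (suc K)) (conv-D≤err tel K r t K ℕ.≤-refl)) ⟩
  (T x (suc r) (suc t) (suc K) ℚ.+ err K r t) ℚ.+ e t                 ≡⟨ ℚ.+-assoc (T x (suc r) (suc t) (suc K)) (err K r t) (e t) ⟩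
  T x (suc r) (suc t) (suc K) ℚ.+ (err K r t ℚ.+ e t)                 ∎
  where open ℚ.≤-Reasoning

-- Comparison of T′ with T

-- As P(K) > 0, the bracket in `conv` is positive, and replacing its outer factor b by a is already
-- strict.
conv-mono-< : ∀ {a b P} → 0ℚ ℚ.≤ b → b ℚ.< a → (∀ j → 0ℚ ℚ.≤ P j) → ∀ K → 0ℚ ℚ.< P K →
              conv b P (suc K) ℚ.< conv a P (suc K)
conv-mono-< {a} {b} {P} 0≤b b<a 0≤P K 0<PK = ℚ.<-≤-trans
  (ℚ.*-monoˡ-<-pos (P K ℚ.+ conv b P K) {{ℚ.positive (ℚ.+-mono-<-≤ 0<PK (conv-nonneg 0≤b 0≤P K))}} b<a)
  (ℚ.*-monoˡ-≤-nonNeg a {{ℚ.nonNegative (ℚ.≤-trans 0≤b (ℚ.<⇒≤ b<a))}} (ℚ.+-monoʳ-≤ (P K) (conv-mono 0≤b (ℚ.<⇒≤ b<a) 0≤P K)))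

-- With cut-off 1 every nᵢ equals 1. Some composition of r + 1 + d into r + 1 positive parts exists,
-- and it contributes a power of x(1).
conv-D-pos : ∀ {x} → Telescoping x → ∀ r d → 0ℚ ℚ.< conv (x 1) (D x r 1) (suc (r ℕ.+ d))
conv-D-pos {x} tel zero zero = 0<* (x 1) _ (Telescoping.pos tel 1) 0<1ℚ
conv-D-pos {x} tel zero (suc d) = 0<* (x 1) _ (Telescoping.pos tel 1) (ℚ.+-mono-≤-< ℚ.≤-refl (conv-D-pos tel zero d))
conv-D-pos {x} tel (suc r) d = 0<* (x 1) _ (Telescoping.pos tel 1)
  (ℚ.+-mono-<-≤ (ℚ.+-mono-<-≤ (conv-D-pos tel r d) ℚ.≤-refl)
    (conv-nonneg (Telescoping.nonneg tel 1) (D-nonneg tel (suc r) 1) (suc (r ℕ.+ d))))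

gap : (ℕ → ℚ) → ℕ → ℕ → ℕ → ℚ
gap x r K t = T x (suc r) t K ℚ.- T′ x r t K

-- As x decreases, each summand of `T` dominates that of `T′`; a gap that has opened at one cut-off
-- therefore persists.
gap-mono : ∀ {x} → Telescoping x → ∀ r K {s t} → s ℕ.≤ t → gap x r K s ℚ.≤ gap x r K t
gap-mono {x} tel r K {s} {t} s≤t = subst₂ ℚ._≤_ (∑ℚ-- (upTo s) f g) (∑ℚ-- (upTo t) f g)
  (∑ℚ-upTo-mono (λ i → p≤q⇒0≤q-p (conv-mono (nonneg (suc i)) (decreasing i)
    (conv-nonneg (nonneg (suc i)) (D-nonneg tel r (suc i))) K)) s≤t)
  where
  open Telescoping tel
  f g : ℕ → ℚ
  f i = conv (x i) (conv (x (suc i)) (D x r (suc i))) K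
  g i = conv (x (suc i)) (conv (x (suc i)) (D x r (suc i))) K

-- Only n₁ = n₂ = ⋯ = 1 is left at cut-off 1. The weight is large enough for positive k₀, k₁, ... to
-- exist, and x(1) < x(0) makes the comparison strict.
gap-pos : ∀ {x} → Telescoping x → ∀ r d → 0ℚ ℚ.< gap x r (suc r ℕ.+ suc d) 1
gap-pos {x} tel r d rewrite ℕ.+-suc r d = subst (ℚ._< gap x r (suc (suc (r ℕ.+ d))) 1) (ℚ.+-inverseʳ (T′ x r 1 (suc (suc (r ℕ.+ d)))))
  (ℚ.+-monoˡ-< (ℚ.- T′ x r 1 (suc (suc (r ℕ.+ d)))) (ℚ.+-monoˡ-< 0ℚ
    (conv-mono-< {x 0} (nonneg 1) (0<step⇒< (0<step 0)) (conv-nonneg (nonneg 1) (D-nonneg tel r 1)) (suc (r ℕ.+ d)) (conv-D-pos tel r d))))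
  where
  open Telescoping tel
  0<step⇒< : ∀ {p q} → 0ℚ ℚ.< p ℚ.- q → q ℚ.< p
  0<step⇒< {p} {q} h = subst₂ ℚ._<_ (ℚ.+-identityʳ q) (ring₂ p q) (ℚ.+-monoʳ-< q h)

T→L-uniform : ∀ r K ε → 0ℚ ℚ.< ε → ∃ λ N → ∀ {x} → Telescoping x → ∀ t → N ℕ.≤ t → L x r K ℚ.- T x r t K ℚ.≤ ε
T→L-uniform r K ε 0<ε with T→L r K
... | e , e→0 , h = let (N , hN) = e→0 ε 0<ε in suc N , λ { {x} tel (suc t) (s≤s N≤t) →
  ℚ.≤-trans (p≤q+r⇒p-q≤r {L x r K} {T x r (suc t) K} (h tel t)) (hN t N≤t) }

-- Monotonicity in the cut-off

^-nonneg : ∀ {p} → 0ℚ ℚ.≤ p → ∀ n → 0ℚ ℚ.≤ p ^ n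
^-nonneg 0≤p zero    = ℚ.<⇒≤ 0<1ℚ
^-nonneg 0≤p (suc n) = *-nonneg 0≤p (^-nonneg 0≤p n)

chainSum-nonneg : ∀ {x} → Telescoping x → ∀ {r} (k : Vec ℕ r) t → 0ℚ ℚ.≤ chainSum x k t
chainSum-nonneg tel []       t = ℚ.<⇒≤ 0<1ℚ
chainSum-nonneg tel (k ∷ ks) t = ∑ℚ-nonneg (upTo t) (λ i _ →
  *-nonneg (^-nonneg (Telescoping.nonneg tel (suc i)) k) (chainSum-nonneg tel ks (suc i)))

chainSum-mono : ∀ {x} → Telescoping x → ∀ {r} (k : Vec ℕ r) {s t} → s ℕ.≤ t → chainSum x k s ℚ.≤ chainSum x k t
chainSum-mono tel []       s≤t = ℚ.≤-refl
chainSum-mono tel (k ∷ ks) s≤t = ∑ℚ-upTo-mono (λ i →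
  *-nonneg (^-nonneg (Telescoping.nonneg tel (suc i)) k) (chainSum-nonneg tel ks (suc i))) s≤t

chainSum₀-mono : ∀ {x} → Telescoping x → ∀ {r} (k : Vec ℕ (suc (suc r))) {s t} → s ℕ.≤ t →
                 chainSum₀ x k s ℚ.≤ chainSum₀ x k t
chainSum₀-mono tel (k₀ ∷ k₁ ∷ ks) s≤t = ∑ℚ-upTo-mono (λ i → *-nonneg (^-nonneg (Telescoping.nonneg tel i) k₀)
  (*-nonneg (^-nonneg (Telescoping.nonneg tel (suc i)) k₁) (chainSum-nonneg tel ks (suc i)))) s≤t

-- The other increments are nonnegative. This is how each single series inherits its modulus of
-- convergence from the total.
increment≤total : ∀ {A : Set} (xs : List A) (f g : A → ℚ) → (∀ x → x ∈ xs → f x ℚ.≤ g x) →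
                  ∀ {x} → x ∈ xs → g x ℚ.- f x ℚ.≤ ∑ℚ xs g ℚ.- ∑ℚ xs f
increment≤total xs f g f≤g {x} x∈ = subst (g x ℚ.- f x ℚ.≤_) (∑ℚ-- xs g f)
  (term≤∑ℚ xs (λ y y∈ → p≤q⇒0≤q-p (f≤g y y∈)) x∈)

compositions-head≥1 : ∀ r K {k} → k ∈ compositionsℕ (suc r) K → 1 ℕ.≤ head k
compositions-head≥1 r K k∈ with find (∈-concatMap⁻ _ {xs = upTo K} k∈)
... | i , _ , k∈map with ∈-map⁻ (suc i ∷_) k∈map
...   | _ , _ , refl = s≤s z≤n

-- Values of the reals at one index of their Cauchy sequences

-- The first component makes `recip` exact at index i: the maximum with the positivity witness is
-- then the entry itself. Both components are preserved by products.
Inverse : ℝ⁺ → ℕ → ℚ → Set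
Inverse X i y = proj₁ (proj₂ X) ℚ.≤ seq ⟦ X ⟧ i × seq ⟦ X ⟧ i ℚ.* y ≡ 1ℚ

stage : ℝ⁺ → ℕ
stage (_ , _ , _ , N , _) = N

settled-from-stage : ∀ X i → stage X ℕ.≤ i → proj₁ (proj₂ X) ℚ.≤ seq ⟦ X ⟧ i
settled-from-stage (x , δ , _ , N , h) i N≤i = subst (ℚ._≤ seq x i) (ℚ.+-identityˡ δ) (h i N≤i)

seq-positive : ∀ X i → stage X ℕ.≤ i → 0ℚ ℚ.< seq ⟦ X ⟧ i
seq-positive X@(_ , _ , 0<δ , _) i N≤i = ℚ.<-≤-trans 0<δ (settled-from-stage X i N≤i)

1/-unique : ∀ p q .{{_ : ℚ.NonZero p}} → p ℚ.* q ≡ 1ℚ → ℚ.1/ p ≡ q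
1/-unique p q pq≡1 = trans (sym (ℚ.*-identityʳ (ℚ.1/ p))) (trans (cong (ℚ.1/ p ℚ.*_) (sym pq≡1))
  (trans (sym (ℚ.*-assoc (ℚ.1/ p) p q)) (trans (cong (ℚ._* q) (ℚ.*-inverseˡ p)) (ℚ.*-identityˡ q))))

seq-1/⁺ : ∀ X i {y} → Inverse X i y → seq ⟦ 1/⁺ X ⟧ i ≡ y
seq-1/⁺ (x , δ , 0<δ , _) i {y} (δ≤x , xy≡1) = 1/-unique (δ ℚ.⊔ seq x i) y {{⊔-nonZero 0<δ (seq x i)}}
  (trans (cong (ℚ._* y) (ℚ.p≤q⇒p⊔q≡q δ≤x)) xy≡1)

inverse-1 : ∀ i → Inverse 1⁺ i 1ℚ
inverse-1 i = ℚ.≤-refl , ℚ.*-identityʳ 1ℚ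

inverse-* : ∀ X Y i {y z} → Inverse X i y → Inverse Y i z → Inverse (X *⁺ Y) i (y ℚ.* z)
inverse-* (a , δ , 0<δ , _) (b , η , 0<η , _) i {y} {z} (δ≤a , ay≡1) (η≤b , bz≡1) =
  (*-mono-≤ δ (seq a i) η (seq b i) (ℚ.<⇒≤ 0<η) (ℚ.≤-trans (ℚ.<⇒≤ 0<δ) δ≤a) δ≤a η≤b) ,
  (trans (rearrange (seq a i) (seq b i) y z) (trans (cong₂ ℚ._*_ ay≡1 bz≡1) (ℚ.*-identityʳ 1ℚ)))
  where
  rearrange : ∀ a b y z → (a ℚ.* b) ℚ.* (y ℚ.* z) ≡ (a ℚ.* y) ℚ.* (b ℚ.* z)
  rearrange = solve 4 (λ a b y z → (a :* b) :* (y :* z) := (a :* y) :* (b :* z)) refl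

inverse-^ : ∀ X i {y} → Inverse X i y → ∀ n → Inverse (X ^⁺ n) i (y ^ n)
inverse-^ X i h zero    = inverse-1 i
inverse-^ X i h (suc n) = inverse-* X (X ^⁺ n) i h (inverse-^ X i h n)

-- x(n₁ - q)^k₁ ⋯ x(nᵣ - q)^kᵣ
monomial : (ℕ → ℚ) → ∀ q {r m} → Vec ℕ r → Vec (ℕ≥ m) r → ℚ
monomial x q []       []             = 1ℚ
monomial x q (k ∷ ks) ((n , _) ∷ ns) = x (n ℕ.∸ q) ^ k ℚ.* monomial x q ks ns

inverse-∏ : ∀ {m x} q i (X : ℕ≥ m → ℝ⁺) → (∀ n → Inverse (X n) i (x (proj₁ n ℕ.∸ q))) →
            ∀ {r} (ks : Vec ℕ r) ns → Inverse (∏⁺ (zipWith (λ n k → X n ^⁺ k) ns ks)) i (monomial x q ks ns)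
inverse-∏ q i X h []       []       = inverse-1 i
inverse-∏ q i X h (k ∷ ks) (n ∷ ns) = inverse-* (X n ^⁺ k) (∏⁺ (zipWith (λ n k → X n ^⁺ k) ns ks)) i
  (inverse-^ (X n) i (h n) k) (inverse-∏ q i X h ks ns)

∑ℚ-chains-∷ : ∀ r q N (f : Vec (ℕ≥ (suc q)) (suc r) → ℚ) → ∑ℚ (chains (suc r) (suc q) N) f ≡
  ∑ℚ (upTo (N ℕ.∸ q)) (λ i → ∑ℚ (chains r (suc q) (suc q ℕ.+ i)) (λ ns → f ((suc q ℕ.+ i , ℕ.m≤m+n (suc q) i) ∷ ns)))
∑ℚ-chains-∷ r q N f = trans (∑ℚ-concatMap _ (range (suc q) N) f) (trans (∑ℚ-map _ (upTo (N ℕ.∸ q)) _)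
  (∑ℚ-cong (upTo (N ℕ.∸ q)) (λ i → ∑ℚ-map _ (chains r (suc q) (suc q ℕ.+ i)) f)))

1+q+i∸q : ∀ q i → suc q ℕ.+ i ℕ.∸ q ≡ suc i
1+q+i∸q q i = trans (cong (ℕ._∸ q) (sym (ℕ.+-suc q i))) (ℕ.m+n∸m≡n q (suc i))

-- Subtracting q from every entry turns the chains between q + 1 and N into chains between 1 and N -
-- q.
∑ℚ-chains-monomial : ∀ x q {r} (ks : Vec ℕ r) N → ∑ℚ (chains r (suc q) N) (monomial x q ks) ≡ chainSum x ks (N ℕ.∸ q)
∑ℚ-chains-monomial x q []             N = ℚ.+-identityʳ 1ℚ
∑ℚ-chains-monomial x q {suc r} (k ∷ ks) N = trans (∑ℚ-chains-∷ r q N (monomial x q (k ∷ ks)))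
  (∑ℚ-cong (upTo (N ℕ.∸ q)) (λ i → trans (∑ℚ-* (chains r (suc q) (suc q ℕ.+ i)) (x (suc q ℕ.+ i ℕ.∸ q) ^ k) (monomial x q ks))
    (trans (cong (x (suc q ℕ.+ i ℕ.∸ q) ^ k ℚ.*_) (∑ℚ-chains-monomial x q ks (suc q ℕ.+ i)))
      (cong (λ j → x j ^ k ℚ.* chainSum x ks j) (1+q+i∸q q i)))))

∑ℚ-chains-chainSum₀ : ∀ x {r} k₀ k₁ (ks : Vec ℕ r) N (f : Vec (ℕ≥ 1) (suc r) → ℚ) →
  (∀ i ns → f ((suc i , ℕ.m≤m+n 1 i) ∷ ns) ≡ x i ^ k₀ ℚ.* (x (suc i) ^ k₁ ℚ.* monomial x 0 ks ns)) →
  ∑ℚ (chains (suc r) 1 N) f ≡ chainSum₀ x (k₀ ∷ k₁ ∷ ks) N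
∑ℚ-chains-chainSum₀ x {r} k₀ k₁ ks N f f≡ = trans (∑ℚ-chains-∷ r 0 N f) (∑ℚ-cong (upTo N) (λ i →
  trans (∑ℚ-cong (chains r 1 (suc i)) (f≡ i))
    (trans (∑ℚ-* (chains r 1 (suc i)) (x i ^ k₀) (λ ns → x (suc i) ^ k₁ ℚ.* monomial x 0 ks ns))
      (cong (x i ^ k₀ ℚ.*_) (trans (∑ℚ-* (chains r 1 (suc i)) (x (suc i) ^ k₁) (monomial x 0 ks))
        (cong (x (suc i) ^ k₁ ℚ.*_) (∑ℚ-chains-monomial x 0 ks (suc i))))))))

module _ (u⁺ : ℝ⁺) (i : ℕ) (stage≤i : stage u⁺ ℕ.≤ i) where

  private
    v : ℚ
    v = seq ⟦ u⁺ ⟧ i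

  module _ {{0<v : 0ℚ ℚ.< v}} where

    inverse-u : Inverse u⁺ i 1/[ 0 + v ]
    inverse-u = (settled-from-stage u⁺ i stage≤i) ,
      (trans (cong (ℚ._* 1/[ 0 + v ]) (sym (ℚ.+-identityˡ v))) (1/[]-inverse 0))

    inverse-shift : ∀ n → Inverse (shift⁺ u⁺ n) i 1/[ n + v ]
    inverse-shift n = (settled-from-stage (shift⁺ u⁺ n) i stage≤i) , 1/[]-inverse n

    inverse-shift-1 : ∀ n (1≤n : 1 ℕ.≤ suc n) → Inverse (shift-1⁺ u⁺ (suc n) 1≤n) i 1/[ n + v ]
    inverse-shift-1 n 1≤n = (settled-from-stage (shift-1⁺ u⁺ (suc n) 1≤n) i stage≤i) ,
      (trans (cong (ℚ._* 1/[ n + v ]) (trans (cong (λ q → q ℚ.+ v ℚ.- 1ℚ) (ι-+ 1 n)) (cancel (ι n) v))) (1/[]-inverse n))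
      where
      cancel : ∀ n v → (1ℚ ℚ.+ n) ℚ.+ v ℚ.- 1ℚ ≡ n ℚ.+ v
      cancel = solve 2 (λ n v → (con 1ℚ :+ n) :+ v :- con 1ℚ := n :+ v) refl

    private
      x : ℕ → ℚ
      x n = 1/[ n + v ]

    seq-term₁ : ∀ {r} k₀ k₁ (ks : Vec ℕ r) j ns → seq (term₁ u⁺ (k₀ ∷ k₁ ∷ ks) ((suc j , ℕ.m≤m+n 1 j) ∷ ns)) i ≡
                x j ^ k₀ ℚ.* (x (suc j) ^ k₁ ℚ.* monomial x 0 ks ns)
    seq-term₁ {r} k₀ k₁ ks j ns = seq-1/⁺ (base₀ ^⁺ k₀ *⁺ rest) i (inverse-* (base₀ ^⁺ k₀) rest i
      (inverse-^ base₀ i (inverse-shift-1 j (ℕ.m≤m+n 1 j)) k₀)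
      (inverse-∏ {x = x} 0 i base (λ n → inverse-shift (proj₁ n)) (k₁ ∷ ks) ((suc j , ℕ.m≤m+n 1 j) ∷ ns)))
      where
      base₀ : ℝ⁺
      base₀ = shift-1⁺ u⁺ (suc j) (ℕ.m≤m+n 1 j)
      base : ℕ≥ 1 → ℝ⁺
      base n = shift⁺ u⁺ (proj₁ n)
      rest : ℝ⁺
      rest = ∏⁺ (zipWith (λ n k → base n ^⁺ k) ((suc j , ℕ.m≤m+n 1 j) ∷ ns) (k₁ ∷ ks))

    seq-∑-term₁ : ∀ {r} (k : Vec ℕ (suc (suc r))) N →
                  seq (∑ (chains (suc r) 1 N) (term₁ u⁺ k)) i ≡ chainSum₀ x k N
    seq-∑-term₁ {r} (k₀ ∷ k₁ ∷ ks) N = trans (seq-∑ (chains (suc r) 1 N) (term₁ u⁺ (k₀ ∷ k₁ ∷ ks)) i)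
      (∑ℚ-chains-chainSum₀ x k₀ k₁ ks N (λ ns → seq (term₁ u⁺ (k₀ ∷ k₁ ∷ ks) ns) i) (seq-term₁ k₀ k₁ ks))

module _ (q : ℕ) {{0<q : 0ℚ ℚ.< ι q}} where

  -- Writing n = (n - q) + q exhibits n as j + u with u = q = m - 1, the choice of u made in (ii).
  inverse-nat : ∀ n (1≤n : 1 ℕ.≤ n) i → q ℕ.≤ n → Inverse (nat⁺ n 1≤n) i 1/[ n ℕ.∸ q + ι q ]
  inverse-nat n 1≤n i q≤n = (settled-from-stage (nat⁺ n 1≤n) i z≤n) ,
    (trans (cong (ℚ._* 1/[ n ℕ.∸ q + ι q ]) (trans (cong ι (sym (ℕ.m∸n+n≡m q≤n))) (ι-+ (n ℕ.∸ q) q))) (1/[]-inverse (n ℕ.∸ q)))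

  inverse-pred : ∀ 2≤m i → Inverse (pred⁺ (suc q) 2≤m) i 1/[ 0 + ι q ]
  inverse-pred 2≤m i = (settled-from-stage (pred⁺ (suc q) 2≤m) i z≤n) ,
    (trans (cong (ℚ._* 1/[ 0 + ι q ]) (trans (cong (ℚ._- 1ℚ) (ι-+ 1 q)) (trans (ring₃ 1ℚ (ι q)) (sym (ℚ.+-identityˡ (ι q)))))) (1/[]-inverse 0))

  seq-term₂ : ∀ (1≤m : 1 ℕ.≤ suc q) {r} (k : Vec ℕ r) ns i →
              seq (term₂ {m = suc q} 1≤m k ns) i ≡ monomial (λ n → 1/[ n + ι q ]) q k ns
  seq-term₂ 1≤m k ns i = seq-1/⁺ (∏⁺ (zipWith (λ n k → base n ^⁺ k) ns k)) i
    (inverse-∏ {x = λ n → 1/[ n + ι q ]} q i base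
      (λ n → inverse-nat (proj₁ n) (ℕ.≤-trans 1≤m (proj₂ n)) i (ℕ.<⇒≤ (proj₂ n))) k ns)
    where
    base : ℕ≥ (suc q) → ℝ⁺
    base n = nat⁺ (proj₁ n) (ℕ.≤-trans 1≤m (proj₂ n))

  seq-∑-term₂ : ∀ (1≤m : 1 ℕ.≤ suc q) {r} (k : Vec ℕ r) N i →
                seq (∑ (chains r (suc q) N) (term₂ 1≤m k)) i ≡ chainSum (λ n → 1/[ n + ι q ]) k (N ℕ.∸ q)
  seq-∑-term₂ 1≤m {r} k N i = trans (seq-∑ (chains r (suc q) N) (term₂ 1≤m k) i)
    (trans (∑ℚ-cong (chains r (suc q) N) (λ ns → seq-term₂ 1≤m k ns i))
      (∑ℚ-chains-monomial (λ n → 1/[ n + ι q ]) q k N))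

-- Limits of sequences of reals

∣p-r∣≤ : ∀ p q r {ε η} → ℚ.∣ p ℚ.- q ∣ ℚ.≤ ε → ℚ.∣ q ℚ.- r ∣ ℚ.≤ η → ℚ.∣ p ℚ.- r ∣ ℚ.≤ ε ℚ.+ η
∣p-r∣≤ p q r {ε} {η} h h′ = subst (λ t → ℚ.∣ t ∣ ℚ.≤ ε ℚ.+ η) (chain p q r)
  (ℚ.≤-trans (ℚ.∣p+q∣≤∣p∣+∣q∣ (p ℚ.- q) (q ℚ.- r)) (ℚ.+-mono-≤ h h′))
  where
  chain : ∀ p q r → (p ℚ.- q) ℚ.+ (q ℚ.- r) ≡ p ℚ.- r
  chain = solve 3 (λ p q r → (p :- q) :+ (q :- r) := p :- r) refl

-- The limit is the diagonal. The Cauchy condition has one modulus for all i ≥ i₀, which allows the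
-- index of the sequence and the index within the real to grow together. The explicit entries are
-- returned because the totals are computed from them.
limit : ∀ (s : ℕ → ℝ) i₀ →
  (∀ ε → 0ℚ ℚ.< ε → ∃ λ N → ∀ n i → N ℕ.≤ n → i₀ ℕ.≤ i → ℚ.∣ seq (s n) i ℚ.- seq (s N) i ∣ ℚ.≤ ε) →
  ∃ λ S → (s ⟶ S) × (∀ i → seq S i ≡ seq (s i) i)
limit s i₀ small = S , converges , λ _ → refl
  where
  S : ℝ
  S = mkℝ (λ i → seq (s i) i) λ ε 0<ε →
    -- ε/4 for passing from the diagonal to `s N`, ε/2 within `s N`, and ε/4 for returning to the
    -- diagonal.
    let (N , hN) = small (½ ℚ.* (½ ℚ.* ε)) (0<½ε (0<½ε 0<ε))
        (M , hM) = cauchy (s N) (½ ℚ.* ε) (0<½ε 0<ε)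
    in (N ℕ.⊔ i₀) ℕ.⊔ M , λ i j hi hj →
      let i≥N  = ℕ.m⊔n≤o⇒m≤o N i₀ (ℕ.m⊔n≤o⇒m≤o (N ℕ.⊔ i₀) M hi)
          i≥i₀ = ℕ.m⊔n≤o⇒n≤o N i₀ (ℕ.m⊔n≤o⇒m≤o (N ℕ.⊔ i₀) M hi)
          j≥N  = ℕ.m⊔n≤o⇒m≤o N i₀ (ℕ.m⊔n≤o⇒m≤o (N ℕ.⊔ i₀) M hj)
          j≥i₀ = ℕ.m⊔n≤o⇒n≤o N i₀ (ℕ.m⊔n≤o⇒m≤o (N ℕ.⊔ i₀) M hj)
      in subst (ℚ.∣ seq (s i) i ℚ.- seq (s j) j ∣ ℚ.≤_) (total ε)
           (∣p-r∣≤ (seq (s i) i) (seq (s N) i) (seq (s j) j) (hN i i i≥N i≥i₀)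
             (∣p-r∣≤ (seq (s N) i) (seq (s N) j) (seq (s j) j)
               (hM i j (ℕ.m⊔n≤o⇒n≤o (N ℕ.⊔ i₀) M hi) (ℕ.m⊔n≤o⇒n≤o (N ℕ.⊔ i₀) M hj))
               (subst (ℚ._≤ ½ ℚ.* (½ ℚ.* ε)) (∣p-q∣≡∣q-p∣ (seq (s j) j) (seq (s N) j)) (hN j j j≥N j≥i₀))))
    where
    total : ∀ ε → ½ ℚ.* (½ ℚ.* ε) ℚ.+ (½ ℚ.* ε ℚ.+ ½ ℚ.* (½ ℚ.* ε)) ≡ ε
    total = solve 1 (λ ε → con ½ :* (con ½ :* ε) :+ (con ½ :* ε :+ con ½ :* (con ½ :* ε)) := ε) refl
  converges : s ⟶ S
  converges ε (δ , 0<δ , Nε , hε) =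
    -- The two distances use δ/2; the other half of δ witnesses the strict inequality.
    let (N , hN) = small (½ ℚ.* (½ ℚ.* δ)) (0<½ε (0<½ε 0<δ))
    in N , λ n N≤n → ½ ℚ.* δ , 0<½ε 0<δ , (N ℕ.⊔ i₀) ℕ.⊔ Nε , λ i hi →
      let i≥N  = ℕ.m⊔n≤o⇒m≤o N i₀ (ℕ.m⊔n≤o⇒m≤o (N ℕ.⊔ i₀) Nε hi)
          i≥i₀ = ℕ.m⊔n≤o⇒n≤o N i₀ (ℕ.m⊔n≤o⇒m≤o (N ℕ.⊔ i₀) Nε hi)
      in ℚ.≤-trans (ℚ.+-monoˡ-≤ (½ ℚ.* δ)
           (∣p-r∣≤ (seq (s n) i) (seq (s N) i) (seq (s i) i) (hN n i N≤n i≥i₀)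
             (subst (ℚ._≤ ½ ℚ.* (½ ℚ.* δ)) (∣p-q∣≡∣q-p∣ (seq (s i) i) (seq (s N) i)) (hN i i i≥N i≥i₀))))
         (subst (ℚ._≤ seq ε i) (total δ) (hε i (ℕ.m⊔n≤o⇒n≤o (N ℕ.⊔ i₀) Nε hi)))
    where
    total : ∀ δ → 0ℚ ℚ.+ δ ≡ (½ ℚ.* (½ ℚ.* δ) ℚ.+ ½ ℚ.* (½ ℚ.* δ)) ℚ.+ ½ ℚ.* δ
    total = solve 1 (λ δ → con 0ℚ :+ δ := (con ½ :* (con ½ :* δ) :+ con ½ :* (con ½ :* δ)) :+ con ½ :* δ) refl

-- The limits come with membership proofs as inputs. Deciding membership turns them into a function
-- on the whole type, with default value 0 off the list.
choose : ∀ {A : Set} → DecidableEquality A → (xs : List A) {Q : A → ℝ → Set} →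
         (∀ k → k ∈ xs → ∃ (Q k)) → ∃ λ S → ∀ k → k ∈ xs → Q k (S k)
choose _≟_ xs {Q} h = (λ k → pick k (k ∈? xs)) , λ k k∈ → holds k k∈ (k ∈? xs)
  where
  open DecMembership _≟_ using (_∈?_)
  pick : ∀ k → Dec (k ∈ xs) → ℝ
  pick k (yes k∈) = proj₁ (h k k∈)
  pick k (no _)   = 0ℝ
  holds : ∀ k → k ∈ xs → (d : Dec (k ∈ xs)) → Q k (pick k d)
  holds k _  (yes k∈) = proj₂ (h k k∈)
  holds k k∈ (no k∉)  = contradiction k∈ k∉

seq-1/⁺-^ᶻ : ∀ X i z {y} n → z ≡ + n → Inverse X i y → seq ⟦ 1/⁺ (X ^ᶻ z) ⟧ i ≡ y ^ n
seq-1/⁺-^ᶻ X i z n refl h = seq-1/⁺ (X ^⁺ n) i (inverse-^ X i h n)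

m+n≡o⇒+o-+m≡+n : ∀ m n {o} → m ℕ.+ n ≡ o → + o ℤ.- + m ≡ + n
m+n≡o⇒+o-+m≡+n m n refl = trans (ℤ.[+m]-[+n]≡m⊖n (m ℕ.+ n) m)
  (trans (ℤ.⊖-≥ (ℕ.m≤m+n m n)) (cong +_ (ℕ.m+n∸m≡n m n)))

∣q-p∣≤ : ∀ p q {ε} → p ℚ.≤ q → q ℚ.- p ℚ.≤ ε → ℚ.∣ q ℚ.- p ∣ ℚ.≤ ε
∣q-p∣≤ p q {ε} p≤q h = subst (ℚ._≤ ε) (sym (ℚ.0≤p⇒∣p∣≡p (p≤q⇒0≤q-p p≤q))) h

m<n⇒∃[d]m+1+d≡n : ∀ {m n} → m ℕ.< n → ∃ λ d → m ℕ.+ suc d ≡ n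
m<n⇒∃[d]m+1+d≡n {m} m<n = let (d , 1+m+d≡n) = ℕ.m≤n⇒∃[o]m+o≡n m<n in d , trans (ℕ.+-suc m d) 1+m+d≡n

-- Part (i): the identity

module Identity (p K d : ℕ) (r+1+d≡K : suc p ℕ.+ suc d ≡ K) (u⁺ : ℝ⁺) where

  r : ℕ
  r = suc p

  xs : List (Vec ℕ (suc r))
  xs = compositionsℕ (suc r) K

  partial : Vec ℕ (suc r) → ℕ → ℝ
  partial k N = ∑ (chains r 1 N) (term₁ u⁺ k)

  module _ (i : ℕ) (stage≤i : stage u⁺ ℕ.≤ i) where

    y : ℕ → ℚ
    y n = 1/[_+_] n (seq ⟦ u⁺ ⟧ i) {{seq-positive u⁺ i stage≤i}}

    y-telescoping : Telescoping y
    y-telescoping = 1/[]-telescoping (seq ⟦ u⁺ ⟧ i) {{seq-positive u⁺ i stage≤i}}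

    seq-partial : ∀ k N → seq (partial k N) i ≡ chainSum₀ y k N
    seq-partial = seq-∑-term₁ u⁺ i stage≤i {{seq-positive u⁺ i stage≤i}}

    -- One series grows no more than the total does, and the total never exceeds `L`.
    increment≤ : ∀ {k} → k ∈ xs → ∀ {M N} → M ℕ.≤ N → chainSum₀ y k N ℚ.- chainSum₀ y k M ℚ.≤ L y r K ℚ.- T y r M K
    increment≤ k∈ {M} {N} M≤N = ℚ.≤-trans
      (increment≤total xs (λ k → chainSum₀ y k M) (λ k → chainSum₀ y k N) (λ k _ → chainSum₀-mono y-telescoping k M≤N) k∈)
      (subst₂ (λ a b → a ℚ.- b ℚ.≤ L y r K ℚ.- T y r M K)
        (sym (∑-compositions-chainSum₀ y p N K)) (sym (∑-compositions-chainSum₀ y p M K))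
        (ℚ.+-monoˡ-≤ (ℚ.- T y r M K) (T≤L y-telescoping r N K)))

  -- The bound N from `T→L-uniform` is independent of x, so it serves at all indices past the stage
  -- of u, as `limit` demands.
  small : ∀ {k} → k ∈ xs → ∀ ε → 0ℚ ℚ.< ε →
    ∃ λ N → ∀ n i → N ℕ.≤ n → stage u⁺ ℕ.≤ i → ℚ.∣ seq (partial k n) i ℚ.- seq (partial k N) i ∣ ℚ.≤ ε
  small {k} k∈ ε 0<ε =
    let (N , hN) = T→L-uniform r K ε 0<ε
    in N , λ n i N≤n h → subst₂ (λ a b → ℚ.∣ a ℚ.- b ∣ ℚ.≤ ε) (sym (seq-partial i h k n)) (sym (seq-partial i h k N))
      (∣q-p∣≤ (chainSum₀ (y i h) k N) (chainSum₀ (y i h) k n) (chainSum₀-mono (y-telescoping i h) k N≤n)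
        (ℚ.≤-trans (increment≤ i h k∈ N≤n) (hN (y-telescoping i h) N ℕ.≤-refl)))

  sums : ∃ λ S → ∀ k → k ∈ xs → (partial k ⟶ S k) × (∀ i → seq (S k) i ≡ seq (partial k i) i)
  sums = choose (Vec.≡-dec ℕ._≟_) xs (λ k k∈ → limit (partial k) (stage u⁺) (small k∈))

  S : Vec ℕ (suc r) → ℝ
  S = proj₁ sums

  -- Each limit is a diagonal, so entry i of their sum is the truncated total with cut-off i,
  -- exactly.
  seq-∑-S : ∀ i h → seq (∑ xs S) i ≡ T (y i h) r i K
  seq-∑-S i h = trans (seq-∑ xs S i)
    (trans (∑ℚ-cong-∈ xs (λ k k∈ → trans (proj₂ (proj₂ sums k k∈) i) (seq-partial i h k i)))
      (∑-compositions-chainSum₀ (y i h) p i K))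

  total : ∑ xs S ≈ ⟦ 1/⁺ (u⁺ ^ᶻ (+ K ℤ.- + r)) ⟧
  total ε 0<ε =
    let (N , hN) = T→L-uniform r K ε 0<ε
    -- The index i is also the cut-off: it must exceed N as a cut-off and the stage of u as an
    -- index.
    in N ℕ.⊔ stage u⁺ , λ i hi →
      let h = ℕ.m⊔n≤o⇒n≤o N (stage u⁺) hi
      in subst₂ (λ a b → ℚ.∣ a ℚ.- b ∣ ℚ.≤ ε) (sym (seq-∑-S i h))
           (trans (L-power (y i h) r d r+1+d≡K) (sym (seq-1/⁺-^ᶻ u⁺ i (+ K ℤ.- + r) (suc d) (m+n≡o⇒+o-+m≡+n r (suc d) r+1+d≡K)
             (inverse-u u⁺ i h {{seq-positive u⁺ i h}}))))
           (subst (ℚ._≤ ε) (∣p-q∣≡∣q-p∣ (L (y i h) r K) (T (y i h) r i K))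
             (∣q-p∣≤ (T (y i h) r i K) (L (y i h) r K) (T≤L (y-telescoping i h) r i K)
               (hN (y-telescoping i h) i (ℕ.m⊔n≤o⇒m≤o N (stage u⁺) hi))))

-- Part (ii): the strict inequality

module Inequality (p n q : ℕ) (1≤m : 1 ℕ.≤ suc q) (2≤m : 2 ℕ.≤ suc q) where

  partial : Vec ℕ (suc p) → ℕ → ℝ
  partial k N = ∑ (chains (suc p) (suc q) N) (term₂ 1≤m k)

  instance
    0<q : 0ℚ ℚ.< ι q
    0<q = ℚ.<-≤-trans 0<1ℚ (fromℕ-mono-≤ {1} {q} (ℕ.s≤s⁻¹ 2≤m))

  y : ℕ → ℚ
  y j = 1/[ j + ι q ]

  y-telescoping : Telescoping y
  y-telescoping = 1/[]-telescoping (ι q)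

  seq-partial : ∀ k N i → seq (partial k N) i ≡ chainSum y k (N ℕ.∸ q)
  seq-partial = seq-∑-term₂ q 1≤m

  weight : Vec ℕ (suc p) → ℚ
  weight k = ι (head k) ℚ.- 1ℚ

  ∑-weighted : ∀ t → ∑ℚ (compositions-k₁≥2 p (+ n)) (λ k → weight k ℚ.* chainSum y k t) ≡ T′ y p t n
  ∑-weighted t = trans
    (∑ℚ-filter (λ k → 2 ℕ.≤? head k) (compositionsℕ (suc p) n) (λ k k∈ k₁≱2 → trans
      (cong (λ j → (ι j ℚ.- 1ℚ) ℚ.* chainSum y k t)
        (ℕ.≤-antisym (ℕ.s≤s⁻¹ (ℕ.≰⇒> k₁≱2)) (compositions-head≥1 p n k∈)))
      (ℚ.*-zeroˡ (chainSum y k t))))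
    (∑-compositions-weighted-chainSum y p t n)

  1≤weight : ∀ {k} → k ∈ compositions-k₁≥2 p (+ n) → 1ℚ ℚ.≤ weight k
  1≤weight k∈ = ℚ.+-monoˡ-≤ (ℚ.- 1ℚ)
    (fromℕ-mono-≤ (proj₂ (∈-filter⁻ (λ k → 2 ℕ.≤? head k) {xs = compositionsℕ (suc p) n} k∈)))

  -- A rearrangement of the monotonicity of the gap.
  T′-increment≤ : ∀ {s t} → s ℕ.≤ t → T′ y p t n ℚ.- T′ y p s n ℚ.≤ T y (suc p) t n ℚ.- T y (suc p) s n
  T′-increment≤ {s} {t} s≤t = subst₂ ℚ._≤_
    (regroup (T y (suc p) s n) (T′ y p s n) (T′ y p t n))
    (regroup′ (T y (suc p) t n) (T′ y p t n) (T y (suc p) s n))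
    (ℚ.+-monoˡ-≤ (T′ y p t n ℚ.- T y (suc p) s n) (gap-mono y-telescoping p n s≤t))
    where
    regroup : ∀ a b d → (a ℚ.- b) ℚ.+ (d ℚ.- a) ≡ d ℚ.- b
    regroup = solve 3 (λ a b d → (a :- b) :+ (d :- a) := d :- b) refl
    regroup′ : ∀ c d a → (c ℚ.- d) ℚ.+ (d ℚ.- a) ≡ c ℚ.- a
    regroup′ = solve 3 (λ c d a → (c :- d) :+ (d :- a) := c :- a) refl

  -- The weight k₁ - 1 is at least 1, so it only enlarges the increment. The weighted increment is
  -- at most that of `T′`, hence that of `T`, hence what `T` lacks to its limit.
  increment≤ : ∀ {k} → k ∈ compositions-k₁≥2 p (+ n) → ∀ {s t} → s ℕ.≤ t →
    chainSum y k t ℚ.- chainSum y k s ℚ.≤ L y (suc p) n ℚ.- T y (suc p) s n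
  increment≤ {k} k∈ {s} {t} s≤t = begin
    b ℚ.- a
      ≡⟨ sym (ℚ.*-identityˡ (b ℚ.- a)) ⟩
    1ℚ ℚ.* (b ℚ.- a)
      ≤⟨ ℚ.*-monoʳ-≤-nonNeg (b ℚ.- a) {{ℚ.nonNegative (p≤q⇒0≤q-p (chainSum-mono y-telescoping k s≤t))}} (1≤weight k∈) ⟩
    weight k ℚ.* (b ℚ.- a)
      ≡⟨ distrib (weight k) b a ⟩
    weight k ℚ.* b ℚ.- weight k ℚ.* a
      ≤⟨ increment≤total (compositions-k₁≥2 p (+ n))
           (λ k → weight k ℚ.* chainSum y k s) (λ k → weight k ℚ.* chainSum y k t)
           (λ k k∈ → ℚ.*-monoˡ-≤-nonNeg (weight k) {{ℚ.nonNegative (ℚ.≤-trans (ℚ.<⇒≤ 0<1ℚ) (1≤weight k∈))}}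
             (chainSum-mono y-telescoping k s≤t)) k∈ ⟩
    ∑ℚ (compositions-k₁≥2 p (+ n)) (λ k → weight k ℚ.* chainSum y k t)
      ℚ.- ∑ℚ (compositions-k₁≥2 p (+ n)) (λ k → weight k ℚ.* chainSum y k s)
      ≡⟨ cong₂ ℚ._-_ (∑-weighted t) (∑-weighted s) ⟩
    T′ y p t n ℚ.- T′ y p s n
      ≤⟨ T′-increment≤ s≤t ⟩
    T y (suc p) t n ℚ.- T y (suc p) s n
      ≤⟨ ℚ.+-monoˡ-≤ (ℚ.- T y (suc p) s n) (T≤L y-telescoping (suc p) t n) ⟩
    L y (suc p) n ℚ.- T y (suc p) s n ∎
    where
    open ℚ.≤-Reasoning
    a b : ℚ
    a = chainSum y k s
    b = chainSum y k t
    distrib : ∀ w b a → w ℚ.* (b ℚ.- a) ≡ w ℚ.* b ℚ.- w ℚ.* a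
    distrib = solve 3 (λ w b a → w :* (b :- a) := w :* b :- w :* a) refl

  small : ∀ {k} → k ∈ compositions-k₁≥2 p (+ n) → ∀ ε → 0ℚ ℚ.< ε →
    ∃ λ N → ∀ N′ i → N ℕ.≤ N′ → 0 ℕ.≤ i → ℚ.∣ seq (partial k N′) i ℚ.- seq (partial k N) i ∣ ℚ.≤ ε
  small {k} k∈ ε 0<ε =
    let (N , hN) = T→L-uniform (suc p) n ε 0<ε
    -- The shift turns the cut-off N′ into N′ - q, hence the added q.
    in N ℕ.+ q , λ N′ i N≤N′ _ →
      let t≤t′ = ℕ.∸-monoˡ-≤ q N≤N′
      in subst₂ (λ a b → ℚ.∣ a ℚ.- b ∣ ℚ.≤ ε) (sym (seq-partial k N′ i)) (sym (seq-partial k (N ℕ.+ q) i))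
        (∣q-p∣≤ (chainSum y k (N ℕ.+ q ℕ.∸ q)) (chainSum y k (N′ ℕ.∸ q)) (chainSum-mono y-telescoping k t≤t′)
          (ℚ.≤-trans (increment≤ k∈ t≤t′) (hN y-telescoping (N ℕ.+ q ℕ.∸ q) (ℕ.≤-reflexive (sym (ℕ.m+n∸n≡m N q))))))

  sums : ∃ λ S → ∀ k → k ∈ compositions-k₁≥2 p (+ n) →
    HasSum (suc p) (suc q) (term₂ 1≤m k) (S k) × (∀ i → seq (S k) i ≡ seq (partial k i) i)
  sums = choose (Vec.≡-dec ℕ._≟_) (compositions-k₁≥2 p (+ n)) (λ k k∈ →
    limit (λ N → ∑ (chains (suc p) (suc q) N) (term₂ 1≤m k)) 0 (small k∈))

  S : Vec ℕ (suc p) → ℝ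
  S = proj₁ sums

  seq-∑-S : ∀ i → seq (∑ (compositions-k₁≥2 p (+ n)) (λ k → (fromℕ (head k) - 1ℝ) * S k)) i ≡ T′ y p (i ℕ.∸ q) n
  seq-∑-S i = trans (seq-∑ (compositions-k₁≥2 p (+ n)) (λ k → (fromℕ (head k) - 1ℝ) * S k) i)
    (trans (∑ℚ-cong-∈ (compositions-k₁≥2 p (+ n)) (λ k k∈ →
        cong (weight k ℚ.*_) (trans (proj₂ (proj₂ sums k k∈) i) (seq-partial k i i))))
      (∑-weighted (i ℕ.∸ q)))

  -- `T′` plus the gap at t is `T`, which is at most `L`. The smaller gap at a fixed s is a margin
  -- that does not depend on t.
  T′+gap≤L : ∀ {s t} → s ℕ.≤ t → T′ y p t n ℚ.+ gap y p n s ℚ.≤ L y (suc p) n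
  T′+gap≤L {s} {t} s≤t = ℚ.≤-trans (ℚ.+-monoʳ-≤ (T′ y p t n) (gap-mono y-telescoping p n s≤t))
    (subst (ℚ._≤ L y (suc p) n) (sym (ring₂ (T y (suc p) t n) (T′ y p t n))) (T≤L y-telescoping (suc p) t n))

  total-small : n ℕ.≤ suc p →
    ∑ (compositions-k₁≥2 p (+ n)) (λ k → (fromℕ (head k) - 1ℝ) * S k)
    < ⟦ 1/⁺ (pred⁺ (suc q) 2≤m ^ᶻ (+ n ℤ.- + suc p)) ⟧
  total-small n≤r =
    let (δ , 0<δ , N , h) = proj₂ (1/⁺ (pred⁺ (suc q) 2≤m ^ᶻ (+ n ℤ.- + suc p)))
    in δ , 0<δ , N , λ i N≤i → ℚ.≤-trans (ℚ.+-monoˡ-≤ δ (lhs≤0 i)) (h i N≤i)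
    where
    lhs≤0 : ∀ i → seq (∑ (compositions-k₁≥2 p (+ n)) (λ k → (fromℕ (head k) - 1ℝ) * S k)) i ℚ.≤ 0ℚ
    -- At s = 0 both sums in the gap are empty, so the margin is 0 and only `T′` ≤ `L` = 0 remains.
    lhs≤0 i = subst₂ ℚ._≤_ (trans (ℚ.+-identityʳ _) (sym (seq-∑-S i)))
      (L-vanishes y (suc p) n n≤r) (T′+gap≤L {0} {i ℕ.∸ q} z≤n)

  total-large : ∀ d → suc p ℕ.+ suc d ≡ n →
    ∑ (compositions-k₁≥2 p (+ n)) (λ k → (fromℕ (head k) - 1ℝ) * S k)
    < ⟦ 1/⁺ (pred⁺ (suc q) 2≤m ^ᶻ (+ n ℤ.- + suc p)) ⟧
  total-large d r+1+d≡n =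
    -- The margin comes from the chain n₁ = ⋯ = nᵣ = m. From index m = q + 1 on, the cut-off i - q
    -- is at least 1, so that this chain is included.
    gap y p n 1 , subst (λ n → 0ℚ ℚ.< gap y p n 1) r+1+d≡n (gap-pos y-telescoping p d) , suc q , λ i q<i →
    subst₂ (λ a b → a ℚ.+ gap y p n 1 ℚ.≤ b) (sym (seq-∑-S i))
      (trans (L-power y (suc p) d r+1+d≡n)
        (sym (seq-1/⁺-^ᶻ (pred⁺ (suc q) 2≤m) i (+ n ℤ.- + suc p) (suc d)
          (m+n≡o⇒+o-+m≡+n (suc p) (suc d) r+1+d≡n) (inverse-pred q 2≤m i))))
      (T′+gap≤L (ℕ.m<n⇒0<n∸m q<i))

  total :
    ∑ (compositions-k₁≥2 p (+ n)) (λ k → (fromℕ (head k) - 1ℝ) * S k)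
    < ⟦ 1/⁺ (pred⁺ (suc q) 2≤m ^ᶻ (+ n ℤ.- + suc p)) ⟧
  total = [ total-small
    , (λ r<n → let (d , r+1+d≡n) = m<n⇒∃[d]m+1+d≡n r<n in total-large d r+1+d≡n)
    ]′ (ℕ.≤-<-connex n (suc p))

theorem1p4 : (p : ℕ) (K : ℤ) → let r = suc p in
    ( + suc r ℤ.≤ K → (u : ℝ) (0<u : 0ℝ < u) →
    ∃ λ (S : Vec ℕ (suc r) → ℝ) →
    (∀ k → k ∈ compositions (suc r) K → HasSum r 1 (term₁ (u , 0<u) k) (S k))
    × ∑ (compositions (suc r) K) S ≈ ⟦ 1/⁺ ((u , 0<u) ^ᶻ (K ℤ.- + r)) ⟧ )
    ×
    ( (m : ℕ) (2≤m : 2 ℕ.≤ m) →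
    ∃ λ (S : Vec ℕ r → ℝ) →
    (∀ k → k ∈ compositions-k₁≥2 p K → HasSum r m (term₂ (≤-trans (n≤1+n 1) 2≤m) k) (S k))
    × ∑ (compositions-k₁≥2 p K) (λ k → (fromℕ (head k) - 1ℝ) * S k)
    < ⟦ 1/⁺ (pred⁺ m 2≤m ^ᶻ (K ℤ.- + r)) ⟧ )
theorem1p4 p (+ n) = identity , inequality
  where
  identity : + suc (suc p) ℤ.≤ + n → (u : ℝ) (0<u : 0ℝ < u) → _
  identity (ℤ.+≤+ r<n) u 0<u = S , (λ k k∈ → proj₁ (proj₂ sums k k∈)) , total
    where open Identity p n (proj₁ (m<n⇒∃[d]m+1+d≡n r<n)) (proj₂ (m<n⇒∃[d]m+1+d≡n r<n)) (u , 0<u)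
  inequality : (m : ℕ) (2≤m : 2 ℕ.≤ m) → _
  inequality (suc q) 2≤m = S , (λ k k∈ → proj₁ (proj₂ sums k k∈)) , total
    where open Inequality p n q (≤-trans (n≤1+n 1) 2≤m) 2≤m
-- A negative K admits no composition: the hypothesis of (i) is absurd, and (ii) says that the empty
-- sum 0 is less than a positive real.
theorem1p4 p -[1+ n ] = (λ ()) , λ m 2≤m →
  (λ _ → 0ℝ) , (λ k ()) , proj₂ (1/⁺ (pred⁺ m 2≤m ^ᶻ (-[1+ n ] ℤ.- + suc p)))
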